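{- Let $q\geq 5$ be an odd prime power and let $\mathcal C$ be an irreducible conic of $\mathrm{PG}(2,q^2)$ containing at least one point of the subplane $\mathrm{PG}(2,q)$. Then $E_q(\mathcal C)=q^2$ if and only if $\mathcal C$ is defined over $\mathbb F_q$.
   Context: $\mathrm{PG}(2,q)$ is canonically embedded in $\mathrm{PG}(2,q^2)$ (points with coordinates in $\mathbb F_q$). With respect to an irreducible conic $\mathcal C$ of $\mathrm{PG}(2,q^2)$, $q$ odd, a point not on $\mathcal C$ is external if it lies on two tangent lines to $\mathcal C$ and internal if it lies on none. $E_q(\mathcal C)$ denotes the number of points of $\mathrm{PG}(2,q)$ that are external to $\mathcal C$. A conic is defined over $\mathbb F_q$ if it has an equation with coefficients in $\mathbb F_q$. -}

module Defs where

open import Data.Nat using (ℕ; zero; suc) renaming (_≡ᵇ_ to _≡ℕᵇ_)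
import Data.Nat as ℕ
open import Data.Nat.Primality using (Prime)
open import Data.Bool using (Bool; true; false; _∧_; not)
open import Data.List using (List; []; _∷_; map; _++_; concatMap; filterᵇ; length)
open import Data.Bool.ListAction using (any; all)
open import Data.List.Membership.Propositional using (_∈_)
open import Data.List.Relation.Unary.Unique.Propositional using (Unique)
open import Data.Product using (_×_; _,_; Σ; ∃)
open import Relation.Binary.PropositionalEquality using (_≡_)
open import Relation.Binary.Definitions using (DecidableEquality)
open import Relation.Nullary using (¬_)
open import Relation.Nullary.Decidable using (isYes)
open import Algebra.Structures using (IsCommutativeRing)

IsPrimePower : ℕ → Set
IsPrimePower q = Σ ℕ λ p → Σ ℕ λ k → Prime p × q ≡ p ℕ.^ suc k

record FiniteField : Set₁ where
  infixl 7 _*_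
  infixl 6 _+_
  field
    Carrier : Set
    _+_ _*_ : Carrier → Carrier → Carrier
    -_ : Carrier → Carrier
    0# 1# : Carrier
    isCommutativeRing : IsCommutativeRing _≡_ _+_ _*_ -_ 0# 1#
    0≢1 : ¬ (0# ≡ 1#)
    inverse : ∀ x → ¬ (x ≡ 0#) → ∃ λ y → y * x ≡ 1#
    _≟_ : DecidableEquality Carrier
    elements : List Carrier
    complete : ∀ x → x ∈ elements
    unique : Unique elements

  order : ℕ
  order = length elements

module PlaneGeometry (F : FiniteField) (q : ℕ) where
  open FiniteField F

  _==_ : Carrier → Carrier → Bool
  x == y = isYes (x ≟ y)

  _^_ : Carrier → ℕ → Carrier
  x ^ zero = 1#
  x ^ suc n = x * (x ^ n)

  2# : Carrier
  2# = 1# + 1#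

  -- F_q inside F_{q^2}: the fixed field of the Frobenius x ↦ x^q
  inFq : Carrier → Bool
  inFq x = (x ^ q) == x

  Triple : Set
  Triple = Carrier × Carrier × Carrier

  -- canonical representatives of the points of PG(2,F):
  -- (1,y,z), (0,1,z), (0,0,1)   (first nonzero coordinate equal to 1);
  -- the same list represents the lines (dual coordinates [u,v,w]).
  projPoints : List Triple
  projPoints =
    concatMap (λ y → map (λ z → (1# , y , z)) elements) elements
    ++ map (λ z → (0# , 1# , z)) elements
    ++ ((0# , 0# , 1#) ∷ [])

  -- points of the subplane PG(2,q): canonical representatives with all
  -- coordinates in F_q
  inSubplane : Triple → Bool
  inSubplane (x , y , z) = inFq x ∧ inFq y ∧ inFq z

  subplanePoints : List Triple
  subplanePoints = filterᵇ inSubplane projPoints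

  count : {A : Set} → (A → Bool) → List A → ℕ
  count p xs = length (filterᵇ p xs)

  incident : Triple → Triple → Bool
  incident (u , v , w) (x , y , z) = (u * x + v * y + w * z) == 0#

  -- A conic given by the quadratic form
  --   a x² + b y² + c z² + 2d xy + 2e xz + 2f yz
  -- (every quadratic form has this shape since q is odd), with symmetric
  -- matrix [[a,d,e],[d,b,f],[e,f,c]].
  record Conic : Set where
    constructor conic
    field
      a b c d e f : Carrier

  coeffs : Conic → List Carrier
  coeffs (conic a b c d e f) = a ∷ b ∷ c ∷ d ∷ e ∷ f ∷ []

  form : Conic → Triple → Carrier
  form (conic a b c d e f) (x , y , z) =
    a * x * x + b * y * y + c * z * z
    + 2# * d * x * y + 2# * e * x * z + 2# * f * y * z

  det : Conic → Carrier
  det (conic a b c d e f) =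
    a * b * c + 2# * d * e * f + - (a * f * f) + - (b * e * e) + - (c * d * d)

  -- irreducible (= non-degenerate, q odd) conic
  Irreducible : Conic → Set
  Irreducible C = ¬ (det C ≡ 0#)

  onConic : Conic → Triple → Bool
  onConic C P = form C P == 0#

  tangent : Conic → Triple → Bool
  tangent C l = count (λ P → onConic C P ∧ incident l P) projPoints ≡ℕᵇ 1

  tangentsThrough : Conic → Triple → ℕ
  tangentsThrough C P = count (λ l → incident l P ∧ tangent C l) projPoints

  external : Conic → Triple → Bool
  external C P = not (onConic C P) ∧ (tangentsThrough C P ≡ℕᵇ 2)

  Eq : Conic → ℕ
  Eq C = count (external C) subplanePoints

  MeetsSubplane : Conic → Set
  MeetsSubplane C = any (onConic C) subplanePoints ≡ true

  DefinedOverFq : Conic → Set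
  DefinedOverFq C = Σ Carrier λ λ' → ¬ (λ' ≡ 0#) ×
    all (λ x → inFq (λ' * x)) (coeffs C) ≡ true

OddNat : ℕ → Set
OddNat q = q ℕ.% 2 ≡ 1

{-# OPTIONS --safe #-}
-- The tangents through a point P form the intersection of the dual conic with the line dual to P; so P is
-- external to the conic Q = 0 exactly when the discriminant -det Q · Q(P) is a nonzero square of 𝔽_{q²}.
-- All elements of 𝔽_q are squares of 𝔽_{q²}, so if Q has coefficients in 𝔽_q, every point of PG(2,q) off
-- the conic is external.
--
-- Conversely, coordinates are changed over 𝔽_q so that a point of the conic in PG(2,q) is (0 : 0 : 1).
-- On a non-tangent line of the pencil through it Q is, in the affine coordinate z, proportional to z + u.
-- If u ∈ 𝔽_q, at most q - 1 points of the line are external; if u ∉ 𝔽_q, at most (q + 1)/2 < q - 1 are,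
-- because z ↦ (z + u)^(q-1) embeds 𝔽_q into the roots of X^((q+1)/2) = const. As at most q points of the
-- tangent are external, a total of q² forces the tangent and the second intersections of all the other
-- q lines of the pencil to be defined over 𝔽_q, and interpolation gives the coefficients.
module Submission where

open import Defs
open import Level using (Level; 0ℓ)
open import Data.Nat.Base as ℕ using (ℕ; zero; suc; _≤_; _<_; z≤n; s≤s; _≡ᵇ_)
import Data.Nat.Properties as ℕ
open import Data.Nat.Divisibility using (_∣_; divides; ∣⇒≤; m∣m*n)
open import Data.Nat.DivMod using (_/_; m≡m%n+[m/n]*n)
open import Data.Nat.Primality using (Prime; euclidsLemma)
open import Data.Nat.Solver using (module +-*-Solver)
open import Data.Integer.Base as ℤ using (ℤ; -[1+_]) renaming (+_ to pos)
import Data.Integer.Properties as ℤ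
open import Data.Bool.Base using (Bool; true; false; _∧_; not)
open import Data.Bool.Properties using (∧-comm; ∧-identityʳ; ∧-zeroʳ; T?; T-≡)
open import Data.Maybe.Base using (Maybe; just; nothing)
open import Data.Fin.Base as Fin using (Fin; toℕ; fromℕ; inject₁)
import Data.Fin.Properties as Fin
open import Data.List.Base using (List; []; _∷_; _++_; concatMap; map; filterᵇ; length; foldr; replicate)
open import Data.List.Properties using (length-++; length-map; length-replicate; map-++; map-∘)
open import Data.List.Relation.Unary.Any as Any using (here; there; any?)
import Data.List.Relation.Unary.Any.Properties as AnyP
open import Data.List.Relation.Unary.All as All using (All; []; _∷_)
import Data.List.Relation.Unary.All.Properties as AllP
open import Data.List.Membership.Propositional using (_∈_; lose; find)
open import Data.List.Membership.Propositional.Properties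
  using (∈-map⁺; ∈-map⁻; ∈-∃++; ∈-++⁺ˡ; ∈-++⁺ʳ; ∈-++⁻; ∈-concatMap⁻; ∈-filter⁺; ∈-filter⁻)
open import Data.List.Membership.Propositional.Properties.WithK using (unique∧set⇒bag)
open import Data.List.Relation.Unary.Unique.Propositional using (Unique; []; _∷_)
import Data.List.Relation.Unary.Unique.Propositional.Properties as UniqueP
open import Data.List.Relation.Binary.BagAndSetEquality using (∼bag⇒↭)
open import Data.List.Relation.Binary.Permutation.Propositional using (_↭_; ↭⇒↭ₛ)
import Data.List.Relation.Binary.Permutation.Propositional.Properties as Perm
import Data.List.Relation.Binary.Permutation.Setoid.Properties as PermSetoid
open import Data.Product using (_×_; _,_; proj₁; proj₂; ∃)
open import Data.Sum using (_⊎_; inj₁; inj₂; [_,_]′)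
open import Function.Base using (_∘_; id; case_of_)
open import Function.Bundles using (_⇔_; mk⇔; Equivalence)
open import Relation.Nullary using (¬_; Dec; yes; no; contradiction)
open import Relation.Nullary.Decidable using (isYes; map′)
open import Relation.Binary.Definitions using (DecidableEquality)
open import Relation.Binary.PropositionalEquality
open import Algebra.Bundles using (CommutativeRing)
open import Algebra.Structures using (IsCommutativeMonoid)
import Algebra.Properties.Ring
import Algebra.Properties.Group
import Algebra.Properties.Semiring.Mult
import Algebra.Properties.Semiring.Mult.TCOptimised
import Algebra.Properties.Semiring.Exp
import Algebra.Properties.Semiring.Sum
import Algebra.Properties.CommutativeSemiring.Exp
import Algebra.Properties.CommutativeSemiring.Binomial
import Algebra.Solver.Ring
import Algebra.Solver.Ring.AlmostCommutativeRing as ACR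

-- The constant q² is q · (q - 1) + q: the pencil has q + 1 lines, its centre lies on the conic, and
-- only a tangent can carry q external points besides the centre. A tangent outside PG(2,q)
-- therefore already costs one point, so its rationality comes first and that of the intersections
-- follows. The obstacle is that points are represented by normal forms, which linear substitutions
-- do not respect. Counts are therefore moved through sums over all vectors: if p counts points with
-- a homogeneous property, v counts vectors and w is the value at the zero vector, then v = w + (n -
-- 1) · p over a field of n elements, so v and w determine p. Over F this counts the points of a
-- conic on a line, over F_q it carries the number of external points through a change of
-- coordinates. For the same reason, rationality is transported as a property of the values of the
-- form on vectors over F_q, and only afterwards read off from the coefficients.

-- Polynomial identities with integer coefficients.

module IntegerSolver (R : CommutativeRing 0ℓ 0ℓ)
  (≈⇒≡ : ∀ {x y} → CommutativeRing._≈_ R x y → x ≡ y) where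

  open CommutativeRing R
    using (Carrier; _+_; _*_; -_; 0#; 1#; ring; semiring; +-group)
    renaming (reflexive to ≡⇒≈)
  private
    module R = CommutativeRing R
    module RP = Algebra.Properties.Ring ring
    module GP = Algebra.Properties.Group +-group
  open Algebra.Properties.Semiring.Mult.TCOptimised semiring
    renaming (_×_ to _×′_)

  open ≡-Reasoning

  -- With these multiples the numerals 0, 1 and 2 denote `0#`, `1#` and `1# + 1#` by computation, so
  -- that solved identities match goals about `2#` without rewriting.
  ⟦_⟧ᶻ : ℤ → Carrier
  ⟦ pos n ⟧ᶻ    = n ×′ 1#
  ⟦ -[1+ n ] ⟧ᶻ = - (suc n ×′ 1#)

  private
    ⟦-pos⟧ : ∀ n → ⟦ ℤ.- pos n ⟧ᶻ ≡ - (n ×′ 1#)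
    ⟦-pos⟧ zero    = sym (≈⇒≡ RP.-0#≈0#)
    ⟦-pos⟧ (suc n) = refl

    neg-homo : ∀ i → ⟦ ℤ.- i ⟧ᶻ ≡ - ⟦ i ⟧ᶻ
    neg-homo (pos n)  = ⟦-pos⟧ n
    neg-homo -[1+ n ] = sym (≈⇒≡ (GP.⁻¹-involutive _))

    cancelˡ : ∀ x y z → (x + y) + - (x + z) ≡ y + - z
    cancelˡ x y z = begin
      (x + y) + - (x + z)     ≡⟨ cong₂ _+_ (≈⇒≡ (R.+-comm x y)) (≈⇒≡ (R.sym (RP.-‿+-comm x z))) ⟩
      (y + x) + (- x + - z)   ≡⟨ ≈⇒≡ (R.+-assoc y x _) ⟩
      y + (x + (- x + - z))   ≡⟨ cong (y +_) (≈⇒≡ (R.sym (R.+-assoc x (- x) (- z)))) ⟩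
      y + (x + - x + - z)     ≡⟨ cong (λ t → y + (t + - z)) (≈⇒≡ (R.-‿inverseʳ x)) ⟩
      y + (0# + - z)          ≡⟨ cong (y +_) (≈⇒≡ (R.+-identityˡ _)) ⟩
      y + - z                 ∎

    ⊖-homo : ∀ m n → ⟦ m ℤ.⊖ n ⟧ᶻ ≡ m ×′ 1# + - (n ×′ 1#)
    ⊖-homo zero    zero    = sym (≈⇒≡ (R.-‿inverseʳ 0#))
    ⊖-homo zero    (suc n) = sym (≈⇒≡ (R.+-identityˡ _))
    ⊖-homo (suc m) zero    = sym (trans (cong (suc m ×′ 1# +_) (≈⇒≡ RP.-0#≈0#)) (≈⇒≡ (R.+-identityʳ _)))
    ⊖-homo (suc m) (suc n) = begin
      ⟦ suc m ℤ.⊖ suc n ⟧ᶻ                      ≡⟨ cong ⟦_⟧ᶻ (ℤ.[1+m]⊖[1+n]≡m⊖n m n) ⟩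
      ⟦ m ℤ.⊖ n ⟧ᶻ                              ≡⟨ ⊖-homo m n ⟩
      m ×′ 1# + - (n ×′ 1#)                     ≡⟨ cancelˡ 1# _ _ ⟨
      (1# + m ×′ 1#) + - (1# + n ×′ 1#)         ≡⟨ cong₂ (λ s t → s + - t) (≈⇒≡ (1+× m 1#)) (≈⇒≡ (1+× n 1#)) ⟨
      suc m ×′ 1# + - (suc n ×′ 1#)             ∎

    +-homo : ∀ i j → ⟦ i ℤ.+ j ⟧ᶻ ≡ ⟦ i ⟧ᶻ + ⟦ j ⟧ᶻ
    +-homo (pos m)  (pos n)  = ≈⇒≡ (×-homo-+ 1# m n)
    +-homo (pos m)  -[1+ n ] = ⊖-homo m (suc n)
    +-homo -[1+ m ] (pos n)  = trans (⊖-homo n (suc m)) (≈⇒≡ (R.+-comm _ _))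
    +-homo -[1+ m ] -[1+ n ] = begin
      - (suc (suc (m ℕ.+ n)) ×′ 1#)           ≡⟨ cong (λ k → - (suc k ×′ 1#)) (ℕ.+-suc m n) ⟨
      - ((suc m ℕ.+ suc n) ×′ 1#)             ≡⟨ cong -_ (≈⇒≡ (×-homo-+ 1# (suc m) (suc n))) ⟩
      - (suc m ×′ 1# + suc n ×′ 1#)           ≡⟨ ≈⇒≡ (RP.-‿+-comm _ _) ⟨
      - (suc m ×′ 1#) + - (suc n ×′ 1#)       ∎

    *-homo⁺ : ∀ m j → ⟦ pos m ℤ.* j ⟧ᶻ ≡ (m ×′ 1#) * ⟦ j ⟧ᶻ
    *-homo⁺ m (pos n) = trans (cong ⟦_⟧ᶻ (sym (ℤ.pos-* m n))) (≈⇒≡ (×1-homo-* m n))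
    *-homo⁺ m -[1+ n ] = begin
      ⟦ pos m ℤ.* -[1+ n ] ⟧ᶻ          ≡⟨ cong ⟦_⟧ᶻ (ℤ.neg-distribʳ-* (pos m) (pos (suc n))) ⟨
      ⟦ ℤ.- (pos m ℤ.* pos (suc n)) ⟧ᶻ ≡⟨ neg-homo (pos m ℤ.* pos (suc n)) ⟩
      - ⟦ pos m ℤ.* pos (suc n) ⟧ᶻ     ≡⟨ cong -_ (*-homo⁺ m (pos (suc n))) ⟩
      - ((m ×′ 1#) * (suc n ×′ 1#))    ≡⟨ ≈⇒≡ (RP.-‿distribʳ-* _ _) ⟩
      (m ×′ 1#) * - (suc n ×′ 1#)      ∎

    *-homo : ∀ i j → ⟦ i ℤ.* j ⟧ᶻ ≡ ⟦ i ⟧ᶻ * ⟦ j ⟧ᶻ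
    *-homo (pos m)  j = *-homo⁺ m j
    *-homo -[1+ m ] j = begin
      ⟦ -[1+ m ] ℤ.* j ⟧ᶻ          ≡⟨ cong ⟦_⟧ᶻ (ℤ.neg-distribˡ-* (pos (suc m)) j) ⟨
      ⟦ ℤ.- (pos (suc m) ℤ.* j) ⟧ᶻ ≡⟨ neg-homo (pos (suc m) ℤ.* j) ⟩
      - ⟦ pos (suc m) ℤ.* j ⟧ᶻ     ≡⟨ cong -_ (*-homo⁺ (suc m) j) ⟩
      - ((suc m ×′ 1#) * ⟦ j ⟧ᶻ)   ≡⟨ ≈⇒≡ (RP.-‿distribˡ-* _ _) ⟩
      - (suc m ×′ 1#) * ⟦ j ⟧ᶻ     ∎

    morphism : ℤ.+-*-rawRing ACR.-Raw-AlmostCommutative⟶ ACR.fromCommutativeRing R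
    morphism = record
      { ⟦_⟧    = ⟦_⟧ᶻ
      ; +-homo = λ i j → ≡⇒≈ (+-homo i j)
      ; *-homo = λ i j → ≡⇒≈ (*-homo i j)
      ; -‿homo = λ i → ≡⇒≈ (neg-homo i)
      ; 0-homo = R.refl
      ; 1-homo = R.refl
      }

    ≟-weak : ∀ i j → Maybe (⟦ i ⟧ᶻ R.≈ ⟦ j ⟧ᶻ)
    ≟-weak i j with i ℤ.≟ j
    ... | yes i≡j = just (≡⇒≈ (cong ⟦_⟧ᶻ i≡j))
    ... | no  _   = nothing

  open Algebra.Solver.Ring ℤ.+-*-rawRing (ACR.fromCommutativeRing R) morphism ≟-weak public
    using (Polynomial; solve; con; _:=_; _:+_; _:*_; _:-_) renaming (:-_ to ⊝_)

  :0 :1 :2 : ∀ {n} → Polynomial n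
  :0 = con (pos 0)
  :1 = con (pos 1)
  :2 = con (pos 2)

-- Finite sums of natural numbers and double counting.

module Counting where

  open import Data.Nat.Base using (_+_; _*_)
  open import Data.Nat.Properties
  open import Data.Nat.ListAction using (sum)
  open import Data.Nat.ListAction.Properties using (sum-↭; sum-++)
  open import Algebra.Properties.CommutativeSemigroup +-commutativeSemigroup using (x∙yz≈y∙xz)

  private variable
    a b : Level
    A : Set a
    B : Set b

  𝟙 : Bool → ℕ
  𝟙 true  = 1
  𝟙 false = 0

  𝟙≤1 : ∀ b → 𝟙 b ≤ 1
  𝟙≤1 true  = ≤-refl
  𝟙≤1 false = z≤n

  ⇔⇒≡ : ∀ {b c : Bool} → (b ≡ true → c ≡ true) → (c ≡ true → b ≡ true) → b ≡ c
  ⇔⇒≡ {true}  {c}     f g = sym (f refl)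
  ⇔⇒≡ {false} {true}  f g = g refl
  ⇔⇒≡ {false} {false} f g = refl

  ≢true⇒≡false : ∀ {b} → ¬ (b ≡ true) → b ≡ false
  ≢true⇒≡false {true}  h = contradiction refl h
  ≢true⇒≡false {false} h = refl

  ∑ : List A → (A → ℕ) → ℕ
  ∑ xs f = sum (map f xs)

  syntax ∑ xs (λ x → e) = ∑[ x ← xs ] e

  ∑-cong-∈ : ∀ {f g : A → ℕ} xs → (∀ x → x ∈ xs → f x ≡ g x) → ∑ xs f ≡ ∑ xs g
  ∑-cong-∈ []       h = refl
  ∑-cong-∈ (x ∷ xs) h = cong₂ _+_ (h x (here refl)) (∑-cong-∈ xs λ y → h y ∘ there)

  ∑-cong : ∀ {f g : A → ℕ} xs → (∀ x → f x ≡ g x) → ∑ xs f ≡ ∑ xs g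
  ∑-cong xs h = ∑-cong-∈ xs λ x _ → h x

  ∑-mono-≤ : ∀ {f g : A → ℕ} xs → (∀ x → x ∈ xs → f x ≤ g x) → ∑ xs f ≤ ∑ xs g
  ∑-mono-≤ []       h = z≤n
  ∑-mono-≤ (x ∷ xs) h = +-mono-≤ (h x (here refl)) (∑-mono-≤ xs λ y → h y ∘ there)

  +-mono-≤-tightˡ : ∀ {m n p q} → m ≤ n → p ≤ q → m + p ≡ n + q → m ≡ n
  +-mono-≤-tightˡ {m} {n} {p} {q} m≤n p≤q eq =
    ≤-antisym m≤n (+-cancelʳ-≤ p n m (≤-trans (+-monoʳ-≤ n p≤q) (≤-reflexive (sym eq))))

  +-mono-≤-tightʳ : ∀ {m n p q} → m ≤ n → p ≤ q → m + p ≡ n + q → p ≡ q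
  +-mono-≤-tightʳ {m} {n} {p} {q} m≤n p≤q eq =
    +-mono-≤-tightˡ p≤q m≤n (trans (+-comm p m) (trans eq (+-comm n q)))

  -- The rigidity behind the converse: once the total attains the bound, every single line of the
  -- pencil attains its own.
  ∑-mono-≤-tight : ∀ {f g : A → ℕ} xs → (∀ x → x ∈ xs → f x ≤ g x) →
    ∑ xs f ≡ ∑ xs g → ∀ x → x ∈ xs → f x ≡ g x
  ∑-mono-≤-tight (x ∷ xs) h eq y (here refl) =
    +-mono-≤-tightˡ (h x (here refl)) (∑-mono-≤ xs λ y → h y ∘ there) eq
  ∑-mono-≤-tight (x ∷ xs) h eq y (there y∈) =
    ∑-mono-≤-tight xs (λ y → h y ∘ there)
      (+-mono-≤-tightʳ (h x (here refl)) (∑-mono-≤ xs λ y → h y ∘ there) eq) y y∈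

  ∑-const : ∀ (xs : List A) k → ∑[ _ ← xs ] k ≡ length xs * k
  ∑-const []       k = refl
  ∑-const (x ∷ xs) k = cong (k +_) (∑-const xs k)

  ∑-zero : ∀ (xs : List A) {f : A → ℕ} → (∀ x → x ∈ xs → f x ≡ 0) → ∑ xs f ≡ 0
  ∑-zero xs h = trans (∑-cong-∈ xs h) (trans (∑-const xs 0) (*-zeroʳ (length xs)))

  +-interchange : ∀ m n p q → (m + n) + (p + q) ≡ (m + p) + (n + q)
  +-interchange m n p q = begin
    (m + n) + (p + q)  ≡⟨ +-assoc m n (p + q) ⟩
    m + (n + (p + q))  ≡⟨ cong (m +_) (x∙yz≈y∙xz n p q) ⟩
    m + (p + (n + q))  ≡⟨ +-assoc m p (n + q) ⟨
    (m + p) + (n + q)  ∎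
    where open ≡-Reasoning

  ∑-distrib-+ : ∀ (xs : List A) (f g : A → ℕ) → ∑[ x ← xs ] (f x + g x) ≡ ∑ xs f + ∑ xs g
  ∑-distrib-+ []       f g = refl
  ∑-distrib-+ (x ∷ xs) f g =
    trans (cong (f x + g x +_) (∑-distrib-+ xs f g)) (+-interchange (f x) (g x) _ _)

  ∑-swap : ∀ (xs : List A) (ys : List B) (f : A → B → ℕ) →
    ∑[ x ← xs ] ∑[ y ← ys ] f x y ≡ ∑[ y ← ys ] ∑[ x ← xs ] f x y
  ∑-swap []       ys f = sym (∑-zero ys λ _ _ → refl)
  ∑-swap (x ∷ xs) ys f = trans (cong (∑ ys (f x) +_) (∑-swap xs ys f))
    (sym (∑-distrib-+ ys (f x) (λ y → ∑[ x ← xs ] f x y)))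

  ∑-∈-≤ : ∀ (f : A → ℕ) {xs x} → x ∈ xs → f x ≤ ∑ xs f
  ∑-∈-≤ f {x ∷ xs} (here refl) = m≤m+n (f x) _
  ∑-∈-≤ f {x ∷ xs} (there x∈)  = ≤-trans (∑-∈-≤ f x∈) (m≤n+m _ (f x))

  ∑≡0⇒≡0 : ∀ (f : A → ℕ) {xs} → ∑ xs f ≡ 0 → ∀ {x} → x ∈ xs → f x ≡ 0
  ∑≡0⇒≡0 f eq x∈ = n≤0⇒n≡0 (subst (f _ ≤_) eq (∑-∈-≤ f x∈))

  -- The `k` added on the left stands in for the exceptional entry, so that no subtraction
  -- `length xs - 1` is needed.
  ∑-all-but-one : ∀ {f : A → ℕ} {k} xs → Unique xs → ∀ {r} → r ∈ xs →
    (∀ x → x ∈ xs → ¬ (x ≡ r) → f x ≡ k) → ∑ xs f + k ≡ f r + length xs * k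
  ∑-all-but-one {f = f} {k} (x ∷ xs) (x∉xs ∷ _) (here refl) h = begin
    f x + ∑ xs f + k          ≡⟨ cong (λ t → f x + t + k) (∑-cong-∈ xs λ y y∈ →
                                   h y (there y∈) (≢-sym (All.lookup x∉xs y∈))) ⟩
    f x + ∑[ _ ← xs ] k + k   ≡⟨ cong (λ t → f x + t + k) (∑-const xs k) ⟩
    f x + length xs * k + k   ≡⟨ +-assoc (f x) _ k ⟩
    f x + (length xs * k + k) ≡⟨ cong (f x +_) (+-comm _ k) ⟩
    f x + (k + length xs * k) ∎
    where open ≡-Reasoning
  ∑-all-but-one {f = f} {k} (x ∷ xs) (x∉xs ∷ xs!) {r} (there r∈) h = begin
    f x + ∑ xs f + k          ≡⟨ +-assoc (f x) _ k ⟩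
    f x + (∑ xs f + k)        ≡⟨ cong₂ _+_ (h x (here refl) (All.lookup x∉xs r∈))
                                   (∑-all-but-one xs xs! r∈ λ y → h y ∘ there) ⟩
    k + (f r + length xs * k) ≡⟨ x∙yz≈y∙xz k (f r) _ ⟩
    f r + (k + length xs * k) ∎
    where open ≡-Reasoning

  ∑-only : ∀ {f : A → ℕ} xs → Unique xs → ∀ {r} → r ∈ xs →
    (∀ x → x ∈ xs → ¬ (x ≡ r) → f x ≡ 0) → ∑ xs f ≡ f r
  ∑-only {f = f} xs xs! {r} r∈ h = begin
    ∑ xs f                 ≡⟨ +-identityʳ _ ⟨
    ∑ xs f + 0             ≡⟨ ∑-all-but-one xs xs! r∈ h ⟩
    f r + length xs * 0    ≡⟨ cong (f r +_) (*-zeroʳ (length xs)) ⟩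
    f r + 0                ≡⟨ +-identityʳ _ ⟩
    f r                    ∎
    where open ≡-Reasoning

  length-filterᵇ : ∀ (p : A → Bool) xs → length (filterᵇ p xs) ≡ ∑[ x ← xs ] 𝟙 (p x)
  length-filterᵇ p []       = refl
  length-filterᵇ p (x ∷ xs) with p x
  ... | true  = cong suc (length-filterᵇ p xs)
  ... | false = length-filterᵇ p xs

  ∑-filterᵇ : ∀ (p : A → Bool) (f : A → ℕ) xs → ∑ (filterᵇ p xs) f ≡ ∑[ x ← xs ] (𝟙 (p x) * f x)
  ∑-filterᵇ p f []       = refl
  ∑-filterᵇ p f (x ∷ xs) with p x
  ... | true  = cong₂ _+_ (sym (+-identityʳ (f x))) (∑-filterᵇ p f xs)
  ... | false = ∑-filterᵇ p f xs

  filterᵇ-Unique : ∀ (p : A → Bool) {xs} → Unique xs → Unique (filterᵇ p xs)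
  filterᵇ-Unique p = UniqueP.filter⁺ (T? ∘ p)

  ∈-filterᵇ⁺ : ∀ (p : A → Bool) {x xs} → x ∈ xs → p x ≡ true → x ∈ filterᵇ p xs
  ∈-filterᵇ⁺ p x∈ px = ∈-filter⁺ (T? ∘ p) x∈ (Equivalence.from T-≡ px)

  ∈-filterᵇ⁻ : ∀ (p : A → Bool) {x} xs → x ∈ filterᵇ p xs → x ∈ xs × p x ≡ true
  ∈-filterᵇ⁻ p xs x∈ = let x∈xs , Tpx = ∈-filter⁻ (T? ∘ p) {xs = xs} x∈ in
    x∈xs , Equivalence.to T-≡ Tpx

  -- Both lists are free of duplicates and have the same members; for such lists equality as sets is
  -- already equality as bags.
  map-↭ : ∀ (σ τ : A → A) {xs} → Unique xs →
    (∀ {x} → x ∈ xs → σ x ∈ xs) → (∀ {x} → x ∈ xs → τ x ∈ xs) →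
    (∀ x → τ (σ x) ≡ x) → (∀ x → σ (τ x) ≡ x) → map σ xs ↭ xs
  map-↭ σ τ {xs} xs! σ∈ τ∈ τσ στ = ∼bag⇒↭ (unique∧set⇒bag
    (UniqueP.map⁺ (λ {x} {y} eq → trans (sym (τσ x)) (trans (cong τ eq) (τσ y))) xs!) xs!
    (mk⇔ (λ y∈ → let x , x∈ , eq = ∈-map⁻ σ y∈ in subst (_∈ xs) (sym eq) (σ∈ x∈))
         (λ y∈ → subst (_∈ map σ xs) (στ _) (∈-map⁺ σ (τ∈ y∈)))))

  ∑-reindex : ∀ (f : A → ℕ) (σ τ : A → A) {xs} → Unique xs →
    (∀ {x} → x ∈ xs → σ x ∈ xs) → (∀ {x} → x ∈ xs → τ x ∈ xs) →
    (∀ x → τ (σ x) ≡ x) → (∀ x → σ (τ x) ≡ x) → ∑[ x ← xs ] f (σ x) ≡ ∑ xs f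
  ∑-reindex f σ τ {xs} xs! σ∈ τ∈ τσ στ =
    trans (cong sum (map-∘ xs)) (sum-↭ (Perm.map⁺ f (map-↭ σ τ xs! σ∈ τ∈ τσ στ)))

  Unique-⊆⇒length-≤ : ∀ {xs ys : List A} → Unique xs → (∀ {x} → x ∈ xs → x ∈ ys) → length xs ≤ length ys
  Unique-⊆⇒length-≤ {xs = []}     _            _   = z≤n
  Unique-⊆⇒length-≤ {xs = x ∷ xs} (x∉xs ∷ xs!) xs⊆ys with ∈-∃++ (xs⊆ys (here refl))
  ... | as , bs , refl = begin
    suc (length xs)              ≤⟨ s≤s (Unique-⊆⇒length-≤ xs! xs⊆) ⟩
    suc (length (as ++ bs))      ≡⟨ cong suc (length-++ as) ⟩
    suc (length as + length bs)  ≡⟨ +-suc (length as) (length bs) ⟨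
    length as + suc (length bs)  ≡⟨ length-++ as ⟨
    length (as ++ x ∷ bs)        ∎
    where
    open ≤-Reasoning
    xs⊆ : ∀ {y} → y ∈ xs → y ∈ as ++ bs
    xs⊆ {y} y∈ with ∈-++⁻ as (xs⊆ys (there y∈))
    ... | inj₁ y∈as         = ∈-++⁺ˡ y∈as
    ... | inj₂ (here refl)  = contradiction refl (All.lookup x∉xs y∈)
    ... | inj₂ (there y∈bs) = ∈-++⁺ʳ as y∈bs

  isYes-refl : (_≟_ : DecidableEquality A) → ∀ x → isYes (x ≟ x) ≡ true
  isYes-refl _≟_ x with x ≟ x
  ... | yes _ = refl
  ... | no ¬p = contradiction refl ¬p

  -- Double counting of the pairs (x, y) with g x = y.
  length-≤-fibres : (_≟_ : DecidableEquality B) (g : A → B) (xs : List A) (ys : List B) (k : ℕ) →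
    (∀ x → x ∈ xs → g x ∈ ys) → (∀ y → ∑[ x ← xs ] 𝟙 (isYes (g x ≟ y)) ≤ k) →
    length xs ≤ length ys * k
  length-≤-fibres _≟_ g xs ys k g∈ fib = begin
    length xs                                             ≡⟨ *-identityʳ _ ⟨
    length xs * 1                                         ≡⟨ ∑-const xs 1 ⟨
    ∑[ x ← xs ] 1                                         ≤⟨ ∑-mono-≤ xs (λ x x∈ →
      ≤-trans (≤-reflexive (sym (cong 𝟙 (isYes-refl _≟_ (g x)))))
              (∑-∈-≤ (λ y → 𝟙 (isYes (g x ≟ y))) (g∈ x x∈))) ⟩
    ∑[ x ← xs ] ∑[ y ← ys ] 𝟙 (isYes (g x ≟ y))           ≡⟨ ∑-swap xs ys _ ⟩
    ∑[ y ← ys ] ∑[ x ← xs ] 𝟙 (isYes (g x ≟ y))           ≤⟨ ∑-mono-≤ ys (λ y _ → fib y) ⟩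
    ∑[ y ← ys ] k                                         ≡⟨ ∑-const ys k ⟩
    length ys * k                                         ∎
    where open ≤-Reasoning

  ∑-++ : ∀ xs ys (f : A → ℕ) → ∑ (xs ++ ys) f ≡ ∑ xs f + ∑ ys f
  ∑-++ xs ys f = trans (cong sum (map-++ f xs ys)) (sum-++ (map f xs) (map f ys))

  ∑-map : ∀ (g : B → A) (f : A → ℕ) xs → ∑ (map g xs) f ≡ ∑ xs (f ∘ g)
  ∑-map g f xs = cong sum (sym (map-∘ xs))

  ∑-concatMap : ∀ (g : B → List A) (f : A → ℕ) xs → ∑ (concatMap g xs) f ≡ ∑[ x ← xs ] ∑ (g x) f
  ∑-concatMap g f []       = refl
  ∑-concatMap g f (x ∷ xs) = trans (∑-++ (g x) (concatMap g xs) f) (cong (∑ (g x) f +_) (∑-concatMap g f xs))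

  Unique-map-∈ : ∀ (f : A → B) {xs : List A} →
    (∀ {x y} → x ∈ xs → y ∈ xs → f x ≡ f y → x ≡ y) → Unique xs → Unique (map f xs)
  Unique-map-∈ f {[]}     inj []            = []
  Unique-map-∈ f {x ∷ xs} inj (x∉xs ∷ xs!) =
    All.tabulate (λ fy∈ eq → let y , y∈ , fy≡ = ∈-map⁻ f fy∈ in
      All.lookup x∉xs y∈ (inj (here refl) (there y∈) (trans eq fy≡)))
    ∷ Unique-map-∈ f (λ x∈ y∈ → inj (there x∈) (there y∈)) xs!

open Counting

-- Divisibility of binomial coefficients by a prime.

module BinomialCoefficients where

  open import Data.Nat.Combinatorics using (_C_; nC1≡n; nCk+nC[k+1]≡[n+1]C[k+1]; k>n⇒nCk≡0)

  suc*C : ∀ n k → suc k ℕ.* (suc n C suc k) ≡ suc n ℕ.* (n C k)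
  suc*C n       zero    = trans (ℕ.*-identityˡ _) (trans (nC1≡n (suc n)) (sym (ℕ.*-identityʳ _)))
  suc*C zero    (suc k) = trans (cong (suc (suc k) ℕ.*_) (k>n⇒nCk≡0 {1} {suc (suc k)} (s≤s (s≤s z≤n))))
    (trans (ℕ.*-zeroʳ (suc (suc k))) (sym (cong (1 ℕ.*_) (k>n⇒nCk≡0 {0} {suc k} (s≤s z≤n)))))
  suc*C (suc n) (suc k) = begin
    suc (suc k) ℕ.* (suc (suc n) C suc (suc k))
      ≡⟨ cong (suc (suc k) ℕ.*_) (nCk+nC[k+1]≡[n+1]C[k+1] (suc n) (suc k)) ⟨
    suc (suc k) ℕ.* (c ℕ.+ (suc n C suc (suc k)))
      ≡⟨ ℕ.*-distribˡ-+ (suc (suc k)) c _ ⟩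
    (c ℕ.+ suc k ℕ.* c) ℕ.+ suc (suc k) ℕ.* (suc n C suc (suc k))
      ≡⟨ cong₂ (λ s t → (c ℕ.+ s) ℕ.+ t) (suc*C n k) (suc*C n (suc k)) ⟩
    (c ℕ.+ suc n ℕ.* (n C k)) ℕ.+ suc n ℕ.* (n C suc k)
      ≡⟨ ℕ.+-assoc c _ _ ⟩
    c ℕ.+ (suc n ℕ.* (n C k) ℕ.+ suc n ℕ.* (n C suc k))
      ≡⟨ cong (c ℕ.+_) (ℕ.*-distribˡ-+ (suc n) (n C k) _) ⟨
    c ℕ.+ suc n ℕ.* ((n C k) ℕ.+ (n C suc k))
      ≡⟨ cong (λ t → c ℕ.+ suc n ℕ.* t) (nCk+nC[k+1]≡[n+1]C[k+1] n k) ⟩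
    suc (suc n) ℕ.* c ∎
    where
    open ≡-Reasoning
    c = suc n C suc k

  -- By the absorption identity `suc*C` the prime divides the product of k + 1 and the coefficient,
  -- and it is too large to divide k + 1.
  prime∣C : ∀ {n} → Prime (suc n) → ∀ k → k < n → suc n ∣ (suc n C suc k)
  prime∣C {n} p-prime k k<n
    with euclidsLemma (suc k) (suc n C suc k) p-prime
           (subst (suc n ∣_) (sym (suc*C n k)) (m∣m*n (n C k)))
  ... | inj₁ p∣k = contradiction (∣⇒≤ p∣k) (ℕ.<⇒≱ (s≤s k<n))
  ... | inj₂ p∣C = p∣C

-- Finite fields: roots of polynomials, Fermat's theorem, squares.

module FieldProperties (F : FiniteField) where

  open FiniteField F public
  open ≡-Reasoning

  commutativeRing : CommutativeRing 0ℓ 0ℓ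
  commutativeRing = record { isCommutativeRing = isCommutativeRing }

  open CommutativeRing commutativeRing public
    using (semiring; commutativeSemiring; ring; +-group; +-assoc; +-comm; +-identityˡ; +-identityʳ;
           -‿inverseˡ; -‿inverseʳ; *-assoc; *-comm; *-identityˡ; *-identityʳ; zeroˡ; zeroʳ;
           +-isCommutativeMonoid; *-isCommutativeMonoid)
  open Algebra.Properties.Ring ring public using (-0#≈0#; -‿distribˡ-*)
  open Algebra.Properties.Group +-group public using ()
    renaming (∙-cancelˡ to +-cancelˡ; ∙-cancelʳ to +-cancelʳ; ⁻¹-involutive to -‿involutive;
              inverseˡ-unique to x+y≡0⇒x≡-y; inverseʳ-unique to x+y≡0⇒y≡-x)
  open Algebra.Properties.Semiring.Exp semiring public using (_^_; ^-assocʳ)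
  open Algebra.Properties.CommutativeSemiring.Exp commutativeSemiring public using (^-distrib-*)
  open Algebra.Properties.Semiring.Mult semiring public
    using (×1-homo-*) renaming (_×_ to _×ⁿ_)
  open IntegerSolver commutativeRing id public

  _≢0 : Carrier → Set
  x ≢0 = ¬ (x ≡ 0#)

  1≢0 : 1# ≢0
  1≢0 = 0≢1 ∘ sym

  _⁻¹ : Carrier → Carrier
  x ⁻¹ with x ≟ 0#
  ... | yes _   = 0#
  ... | no  x≢0 = proj₁ (inverse x x≢0)

  ⁻¹-inverseˡ : ∀ {x} → x ≢0 → x ⁻¹ * x ≡ 1#
  ⁻¹-inverseˡ {x} x≢0 with x ≟ 0#
  ... | yes x≡0 = contradiction x≡0 x≢0
  ... | no  x≢0 = proj₂ (inverse x x≢0)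

  ⁻¹-inverseʳ : ∀ {x} → x ≢0 → x * x ⁻¹ ≡ 1#
  ⁻¹-inverseʳ x≢0 = trans (*-comm _ _) (⁻¹-inverseˡ x≢0)

  ⁻¹-cancelˡ : ∀ {x} → x ≢0 → ∀ y → x ⁻¹ * (x * y) ≡ y
  ⁻¹-cancelˡ x≢0 y = trans (sym (*-assoc _ _ y)) (trans (cong (_* y) (⁻¹-inverseˡ x≢0)) (*-identityˡ y))

  ⁻¹-cancelʳ : ∀ {x} → x ≢0 → ∀ y → x * (x ⁻¹ * y) ≡ y
  ⁻¹-cancelʳ x≢0 y = trans (sym (*-assoc _ _ y)) (trans (cong (_* y) (⁻¹-inverseʳ x≢0)) (*-identityˡ y))

  *-cancelˡ : ∀ {x} → x ≢0 → ∀ {y z} → x * y ≡ x * z → y ≡ z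
  *-cancelˡ {x} x≢0 {y} {z} eq =
    trans (sym (⁻¹-cancelˡ x≢0 y)) (trans (cong (x ⁻¹ *_) eq) (⁻¹-cancelˡ x≢0 z))

  integral : ∀ {x y} → x * y ≡ 0# → x ≡ 0# ⊎ y ≡ 0#
  integral {x} {y} xy≡0 with x ≟ 0#
  ... | yes x≡0 = inj₁ x≡0
  ... | no  x≢0 = inj₂ (*-cancelˡ x≢0 (trans xy≡0 (sym (zeroʳ x))))

  *-≢0 : ∀ {x y} → x ≢0 → y ≢0 → (x * y) ≢0
  *-≢0 x≢0 y≢0 xy≡0 = [ x≢0 , y≢0 ]′ (integral xy≡0)

  *-≢0⁻ˡ : ∀ {x y} → (x * y) ≢0 → x ≢0
  *-≢0⁻ˡ {y = y} xy≢0 x≡0 = xy≢0 (trans (cong (_* y) x≡0) (zeroˡ y))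

  *-≢0⁻ʳ : ∀ {x y} → (x * y) ≢0 → y ≢0
  *-≢0⁻ʳ {x} xy≢0 y≡0 = xy≢0 (trans (cong (x *_) y≡0) (zeroʳ x))

  ⁻¹-≢0 : ∀ {x} → x ≢0 → (x ⁻¹) ≢0
  ⁻¹-≢0 x≢0 = *-≢0⁻ˡ (λ eq → 1≢0 (trans (sym (⁻¹-inverseˡ x≢0)) eq))

  -‿≢0 : ∀ {x} → x ≢0 → (- x) ≢0
  -‿≢0 {x} x≢0 -x≡0 = x≢0 (trans (sym (-‿involutive x)) (trans (cong -_ -x≡0) -0#≈0#))

  x-y≡0⇒x≡y : ∀ {x y} → x + - y ≡ 0# → x ≡ y
  x-y≡0⇒x≡y {x} {y} eq = trans (x+y≡0⇒x≡-y _ _ eq) (-‿involutive y)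

  ^-≢0 : ∀ {x} → x ≢0 → ∀ n → (x ^ n) ≢0
  ^-≢0 x≢0 zero    = 1≢0
  ^-≢0 x≢0 (suc n) = *-≢0 x≢0 (^-≢0 x≢0 n)

  1^n≡1 : ∀ n → 1# ^ n ≡ 1#
  1^n≡1 zero    = refl
  1^n≡1 (suc n) = trans (*-identityˡ _) (1^n≡1 n)

  -- The monic polynomial c₀ + c₁X + … + cₘ₋₁Xᵐ⁻¹ + Xᵐ, whose leading coefficient is not listed.
  evalMonic : List Carrier → Carrier → Carrier
  evalMonic []       x = 1#
  evalMonic (c ∷ cs) x = c + x * evalMonic cs x

  -- Synthetic division by X - r: the coefficients of the quotient are the values at `r` of the
  -- successive tails in Horner's scheme.
  quotientMonic : List Carrier → Carrier → List Carrier
  quotientMonic []            r = []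
  quotientMonic (c ∷ [])      r = []
  quotientMonic (c ∷ d ∷ cs)  r = evalMonic (d ∷ cs) r ∷ quotientMonic (d ∷ cs) r

  length-quotientMonic : ∀ c cs r → length (quotientMonic (c ∷ cs) r) ≡ length cs
  length-quotientMonic c []       r = refl
  length-quotientMonic c (d ∷ cs) r = cong suc (length-quotientMonic d cs r)

  evalMonic-quotient : ∀ c cs r x →
    evalMonic (c ∷ cs) x + - evalMonic (c ∷ cs) r ≡ (x + - r) * evalMonic (quotientMonic (c ∷ cs) r) x
  evalMonic-quotient c []       r x =
    solve 3 (λ c r x → (c :+ x :* :1) :- (c :+ r :* :1) := (x :- r) :* :1) refl c r x
  evalMonic-quotient c (d ∷ cs) r x = begin
    (c + x * p x) + - (c + r * p r)       ≡⟨ solve 5 (λ c x r px pr →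
      (c :+ x :* px) :- (c :+ r :* pr) := x :* (px :- pr) :+ (x :- r) :* pr) refl c x r (p x) (p r) ⟩
    x * (p x + - p r) + (x + - r) * p r   ≡⟨ cong (λ t → x * t + (x + - r) * p r) (evalMonic-quotient d cs r x) ⟩
    x * ((x + - r) * s) + (x + - r) * p r ≡⟨ solve 4 (λ x r s pr →
      x :* ((x :- r) :* s) :+ (x :- r) :* pr := (x :- r) :* (pr :+ x :* s)) refl x r s (p r) ⟩
    (x + - r) * (p r + x * s)             ∎
    where
    p = evalMonic (d ∷ cs)
    s = evalMonic (quotientMonic (d ∷ cs) r) x

  -- Each root r splits off a factor X - r. Monic polynomials are never zero, so the induction
  -- carries no side condition and ends at the constant 1, which has no root.
  roots-≤-degree : ∀ cs {xs} → Unique xs → (∀ {x} → x ∈ xs → evalMonic cs x ≡ 0#) → length xs ≤ length cs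
  roots-≤-degree cs       {[]}     _            _     = z≤n
  roots-≤-degree []       {x ∷ xs} _            roots = contradiction (roots (here refl)) 1≢0
  roots-≤-degree (c ∷ cs) {r ∷ xs} (r∉xs ∷ xs!) roots = s≤s (subst (length xs ≤_)
    (length-quotientMonic c cs r) (roots-≤-degree (quotientMonic (c ∷ cs) r) xs! λ {x} x∈ →
      [ (λ x-r≡0 → contradiction (sym (x-y≡0⇒x≡y x-r≡0)) (All.lookup r∉xs x∈)) , id ]′
      (integral (begin
        (x + - r) * evalMonic (quotientMonic (c ∷ cs) r) x     ≡⟨ evalMonic-quotient c cs r x ⟨
        evalMonic (c ∷ cs) x + - evalMonic (c ∷ cs) r
          ≡⟨ cong₂ (λ s t → s + - t) (roots (there x∈)) (roots (here refl)) ⟩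
        0# + - 0#                                              ≡⟨ -‿inverseʳ 0# ⟩
        0#                                                     ∎))))

  evalMonic-replicate-0 : ∀ m x → evalMonic (replicate m 0#) x ≡ x ^ m
  evalMonic-replicate-0 zero    x = refl
  evalMonic-replicate-0 (suc m) x = trans (+-identityˡ _) (cong (x *_) (evalMonic-replicate-0 m x))

  power-roots-≤ : ∀ m c {xs} → Unique xs → (∀ {x} → x ∈ xs → x ^ suc m ≡ c) → length xs ≤ suc m
  power-roots-≤ m c {xs} xs! roots = subst (λ t → length xs ≤ suc t) (length-replicate m)
    (roots-≤-degree (- c ∷ replicate m 0#) xs! λ {x} x∈ → begin
      - c + x * evalMonic (replicate m 0#) x ≡⟨ cong (λ t → - c + x * t) (evalMonic-replicate-0 m x) ⟩
      - c + x ^ suc m                        ≡⟨ cong (- c +_) (roots x∈) ⟩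
      - c + c                                ≡⟨ -‿inverseˡ c ⟩
      0#                                     ∎)

  infix 4 _==_
  _==_ : Carrier → Carrier → Bool
  x == y = isYes (x ≟ y)

  ==⇒≡ : ∀ {x y} → (x == y) ≡ true → x ≡ y
  ==⇒≡ {x} {y} eq with x ≟ y
  ... | yes x≡y = x≡y

  ≡⇒== : ∀ {x y} → x ≡ y → (x == y) ≡ true
  ≡⇒== {x} refl = isYes-refl _≟_ x

  ≢⇒== : ∀ {x y} → ¬ (x ≡ y) → (x == y) ≡ false
  ≢⇒== x≢y = ≢true⇒≡false (x≢y ∘ ==⇒≡)

  nonzeros : List Carrier
  nonzeros = filterᵇ (λ x → not (x == 0#)) elements

  nonzero-test : ∀ {x} → not (x == 0#) ≡ true → x ≢0
  nonzero-test {x} eq refl with () ← trans (sym eq) (cong not (≡⇒== {x} refl))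

  ∈-nonzeros⁺ : ∀ {x} → x ≢0 → x ∈ nonzeros
  ∈-nonzeros⁺ {x} x≢0 = ∈-filterᵇ⁺ (λ x → not (x == 0#)) (complete x) (cong not (≢⇒== x≢0))

  ∈-nonzeros⁻ : ∀ {x} → x ∈ nonzeros → x ≢0
  ∈-nonzeros⁻ x∈ = nonzero-test (proj₂ (∈-filterᵇ⁻ (λ x → not (x == 0#)) elements x∈))

  nonzeros-Unique : Unique nonzeros
  nonzeros-Unique = filterᵇ-Unique _ unique

  ∑-nonzero : ∀ xs → Unique xs → 0# ∈ xs → suc (∑[ x ← xs ] 𝟙 (not (x == 0#))) ≡ length xs
  ∑-nonzero xs xs! 0∈ = begin
    suc (∑ xs nz)            ≡⟨ ℕ.+-comm 1 _ ⟩
    ∑ xs nz ℕ.+ 1            ≡⟨ ∑-all-but-one xs xs! 0∈ (λ x _ x≢0 → cong (𝟙 ∘ not) (≢⇒== x≢0)) ⟩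
    nz 0# ℕ.+ length xs ℕ.* 1 ≡⟨ cong₂ ℕ._+_ (cong (𝟙 ∘ not) (≡⇒== {0#} refl)) (ℕ.*-identityʳ (length xs)) ⟩
    length xs                ∎
    where
    nz : Carrier → ℕ
    nz x = 𝟙 (not (x == 0#))

  suc-length-nonzeros : suc (length nonzeros) ≡ order
  suc-length-nonzeros = trans (cong suc (length-filterᵇ _ elements)) (∑-nonzero elements unique (complete 0#))

  module _ {_∙_ : Carrier → Carrier → Carrier} {ε : Carrier}
           (isCM : IsCommutativeMonoid _≡_ _∙_ ε) where

    open IsCommutativeMonoid isCM using (assoc; comm; identityˡ)

    power : ℕ → Carrier → Carrier
    power n c = foldr _∙_ ε (replicate n c)

    fold-map : ∀ c xs → foldr _∙_ ε (map (c ∙_) xs) ≡ power (length xs) c ∙ foldr _∙_ ε xs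
    fold-map c []       = sym (identityˡ ε)
    fold-map c (x ∷ xs) = begin
      (c ∙ x) ∙ foldr _∙_ ε (map (c ∙_) xs)  ≡⟨ cong ((c ∙ x) ∙_) (fold-map c xs) ⟩
      (c ∙ x) ∙ (cⁿ ∙ X)                     ≡⟨ assoc c x _ ⟩
      c ∙ (x ∙ (cⁿ ∙ X))                     ≡⟨ cong (c ∙_) (assoc x cⁿ X) ⟨
      c ∙ ((x ∙ cⁿ) ∙ X)                     ≡⟨ cong (λ t → c ∙ (t ∙ X)) (comm x cⁿ) ⟩
      c ∙ ((cⁿ ∙ x) ∙ X)                     ≡⟨ cong (c ∙_) (assoc cⁿ x X) ⟩
      c ∙ (cⁿ ∙ (x ∙ X))                     ≡⟨ assoc c cⁿ _ ⟨
      (c ∙ cⁿ) ∙ (x ∙ X)                     ∎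
      where
      cⁿ = power (length xs) c
      X  = foldr _∙_ ε xs

    -- Translation by c permutes xs, so it does not change the product of its members.
    fold-translate : ∀ c c′ {xs} → Unique xs → (∀ y → c′ ∙ (c ∙ y) ≡ y) → (∀ y → c ∙ (c′ ∙ y) ≡ y) →
      (∀ {y} → y ∈ xs → (c ∙ y) ∈ xs) → (∀ {y} → y ∈ xs → (c′ ∙ y) ∈ xs) →
      power (length xs) c ∙ foldr _∙_ ε xs ≡ foldr _∙_ ε xs
    fold-translate c c′ {xs} xs! c′c cc′ c∈ c′∈ = trans (sym (fold-map c xs))
      (PermSetoid.foldr-commMonoid (setoid Carrier) isCM
        (↭⇒↭ₛ (map-↭ (c ∙_) (c′ ∙_) xs! c∈ c′∈ c′c cc′)))

  power-+ : ∀ n c → power +-isCommutativeMonoid n c ≡ n ×ⁿ c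
  power-+ zero    c = refl
  power-+ (suc n) c = cong (c +_) (power-+ n c)

  power-* : ∀ n c → power *-isCommutativeMonoid n c ≡ c ^ n
  power-* zero    c = refl
  power-* (suc n) c = cong (c *_) (power-* n c)

  -- The additive twin of Fermat's theorem: y ↦ 1 + y permutes the field and leaves the sum `S` of
  -- all elements unchanged, while adding 1 once for each element.
  order×1≡0 : order ×ⁿ 1# ≡ 0#
  order×1≡0 = +-cancelʳ S _ _ (begin
    order ×ⁿ 1# + S                             ≡⟨ cong (_+ S) (power-+ order 1#) ⟨
    power +-isCommutativeMonoid order 1# + S    ≡⟨ fold-translate +-isCommutativeMonoid 1# (- 1#) unique
      (λ y → solve 1 (λ y → ⊝ :1 :+ (:1 :+ y) := y) refl y)
      (λ y → solve 1 (λ y → :1 :+ (⊝ :1 :+ y) := y) refl y)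
      (λ _ → complete _) (λ _ → complete _) ⟩
    S                                           ≡⟨ +-identityˡ S ⟨
    0# + S                                      ∎)
    where S = foldr _+_ 0# elements

  fermat : ∀ {x} → x ≢0 → x ^ length nonzeros ≡ 1#
  fermat {x} x≢0 = *-cancelˡ (product≢0 nonzeros ∈-nonzeros⁻) (begin
    P * x ^ length nonzeros                                 ≡⟨ *-comm P _ ⟩
    x ^ length nonzeros * P                                 ≡⟨ cong (_* P) (power-* (length nonzeros) x) ⟨
    power *-isCommutativeMonoid (length nonzeros) x * P     ≡⟨ fold-translate *-isCommutativeMonoid x (x ⁻¹)
      nonzeros-Unique (⁻¹-cancelˡ x≢0) (⁻¹-cancelʳ x≢0)
      (λ y∈ → ∈-nonzeros⁺ (*-≢0 x≢0 (∈-nonzeros⁻ y∈)))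
      (λ y∈ → ∈-nonzeros⁺ (*-≢0 (⁻¹-≢0 x≢0) (∈-nonzeros⁻ y∈))) ⟩
    P                                                       ≡⟨ *-identityʳ P ⟨
    P * 1#                                                  ∎)
    where
    P = foldr _*_ 1# nonzeros
    product≢0 : ∀ xs → (∀ {y} → y ∈ xs → y ≢0) → (foldr _*_ 1# xs) ≢0
    product≢0 []       _  = 1≢0
    product≢0 (y ∷ ys) nz = *-≢0 (nz (here refl)) (product≢0 ys (nz ∘ there))

  IsSquare : Carrier → Set
  IsSquare x = ∃ λ y → y * y ≡ x

  isSquare? : ∀ x → Dec (IsSquare x)
  isSquare? x = map′ (λ i → Any.lookup i , AnyP.lookup-result i) (λ (y , eq) → lose (complete y) eq)
    (any? (λ y → (y * y) ≟ x) elements)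

  isSquare : Carrier → Bool
  isSquare x = isYes (isSquare? x)

  isSquare⁺ : ∀ {x} → IsSquare x → isSquare x ≡ true
  isSquare⁺ {x} sq with isSquare? x
  ... | yes _   = refl
  ... | no  ¬sq = contradiction sq ¬sq

  isSquare⁻ : ∀ {x} → isSquare x ≡ true → IsSquare x
  isSquare⁻ {x} eq with isSquare? x
  ... | yes sq = sq

  isNonzeroSquare : Carrier → Bool
  isNonzeroSquare x = not (x == 0#) ∧ isSquare x

  isNonzeroSquare⁻ : ∀ {x} → isNonzeroSquare x ≡ true → x ≢0 × IsSquare x
  isNonzeroSquare⁻ {x} eq with x ≟ 0#
  ... | no x≢0 = x≢0 , isSquare⁻ eq

  isNonzeroSquare⁺ : ∀ {x} → x ≢0 → IsSquare x → isNonzeroSquare x ≡ true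
  isNonzeroSquare⁺ x≢0 sq = cong₂ _∧_ (cong not (≢⇒== x≢0)) (isSquare⁺ sq)

  x^2≡x*x : ∀ x → x ^ 2 ≡ x * x
  x^2≡x*x x = cong (x *_) (*-identityʳ x)

  square-fibre-≤2 : ∀ c {xs} → Unique xs → ∑[ x ← xs ] 𝟙 (x * x == c) ≤ 2
  square-fibre-≤2 c {xs} xs! = subst (_≤ 2) (length-filterᵇ _ xs)
    (power-roots-≤ 1 c (filterᵇ-Unique _ xs!) λ {x} x∈ →
      trans (x^2≡x*x x) (==⇒≡ (proj₂ (∈-filterᵇ⁻ (λ x → x * x == c) xs x∈))))

  module _ (h : ℕ) (h*2≡ : length nonzeros ≡ h ℕ.* 2) where

    square⇒^h≡1 : ∀ {x} → x ≢0 → IsSquare x → x ^ h ≡ 1#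
    square⇒^h≡1 {x} x≢0 (y , refl) = begin
      (y * y) ^ h           ≡⟨ cong (_^ h) (x^2≡x*x y) ⟨
      (y ^ 2) ^ h           ≡⟨ ^-assocʳ y 2 h ⟩
      y ^ (2 ℕ.* h)         ≡⟨ cong (y ^_) (trans (ℕ.*-comm 2 h) (sym h*2≡)) ⟩
      y ^ length nonzeros   ≡⟨ fermat (*-≢0⁻ˡ x≢0) ⟩
      1#                    ∎

    private
      squares : List Carrier
      squares = filterᵇ isSquare nonzeros

      h≤squares : h ≤ length squares
      h≤squares = ℕ.*-cancelʳ-≤ h (length squares) 2 (subst (_≤ length squares ℕ.* 2) h*2≡
        (length-≤-fibres _≟_ (λ x → x * x) nonzeros squares 2
          (λ x x∈ → ∈-filterᵇ⁺ isSquare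
            (∈-nonzeros⁺ (*-≢0 (∈-nonzeros⁻ x∈) (∈-nonzeros⁻ x∈))) (isSquare⁺ (x , refl)))
          (λ c → square-fibre-≤2 c nonzeros-Unique)))

    -- Euler's criterion by counting. Squaring is at most two-to-one on the 2h units, so at least h
    -- squares are roots of X^h - 1; a nonsquare root would be one root too many.
    ^h≡1⇒square : 0 < h → ∀ {x} → x ≢0 → x ^ h ≡ 1# → IsSquare x
    ^h≡1⇒square (s≤s {n = k} _) {x} x≢0 x^h≡1 with isSquare? x
    ... | yes sq = sq
    ... | no ¬sq = contradiction
      (ℕ.≤-trans (s≤s h≤squares) (power-roots-≤ k 1# {x ∷ squares}
        (All.tabulate (λ y∈ x≡y → ¬sq (subst IsSquare (sym x≡y)
            (isSquare⁻ (proj₂ (∈-filterᵇ⁻ isSquare nonzeros y∈)))))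
          ∷ filterᵇ-Unique _ nonzeros-Unique)
        λ where
          (here refl) → x^h≡1
          (there y∈)  → let y∈nz , sq = ∈-filterᵇ⁻ isSquare nonzeros y∈ in
            square⇒^h≡1 (∈-nonzeros⁻ y∈nz) (isSquare⁻ sq)))
      (ℕ.n≮n _)

-- Additivity of the Frobenius map.

module Frobenius (F : FiniteField) where

  open FieldProperties F
  open ≡-Reasoning
  open import Data.Nat.Combinatorics using (_C_; nCn≡1)
  open BinomialCoefficients using (prime∣C)
  open Algebra.Properties.CommutativeSemiring.Binomial commutativeSemiring
    using (theorem; binomialTerm)
  open Algebra.Properties.Semiring.Sum semiring
    using (sum; sum-init-last; sum-cong-≗; sum-replicate-zero)
  open Algebra.Properties.Semiring.Mult semiring using (×-assoc-*)

  ×ⁿ≡*1 : ∀ n x → n ×ⁿ x ≡ (n ×ⁿ 1#) * x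
  ×ⁿ≡*1 n x = trans (cong (n ×ⁿ_) (sym (*-identityˡ x))) (sym (×-assoc-* n 1# x))

  ∣⇒×ⁿ≡0 : ∀ {p n} → p ×ⁿ 1# ≡ 0# → p ∣ n → ∀ x → n ×ⁿ x ≡ 0#
  ∣⇒×ⁿ≡0 {p} p×1≡0 (divides k refl) x = begin
    (k ℕ.* p) ×ⁿ x                  ≡⟨ ×ⁿ≡*1 (k ℕ.* p) x ⟩
    ((k ℕ.* p) ×ⁿ 1#) * x           ≡⟨ cong (_* x) (×1-homo-* k p) ⟩
    ((k ×ⁿ 1#) * (p ×ⁿ 1#)) * x     ≡⟨ cong (λ t → ((k ×ⁿ 1#) * t) * x) p×1≡0 ⟩
    ((k ×ⁿ 1#) * 0#) * x            ≡⟨ cong (_* x) (zeroʳ _) ⟩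
    0# * x                          ≡⟨ zeroˡ x ⟩
    0#                              ∎

  -- The inner coefficients of the binomial expansion are multiples of p by `prime∣C`, so only its
  -- two extreme terms survive.
  frobenius-+ : ∀ {p} → Prime p → p ×ⁿ 1# ≡ 0# → ∀ x y → (x + y) ^ p ≡ x ^ p + y ^ p
  frobenius-+ {suc n} p-prime p×1≡0 x y = begin
    (x + y) ^ p                                  ≡⟨ theorem p x y ⟩
    sum t                                        ≡⟨ sum-init-last t ⟩
    (t Fin.zero + sum middle) + t (fromℕ p)      ≡⟨ cong₂ (λ s u → (s + sum middle) + u) first last ⟩
    (y ^ p + sum middle) + x ^ p                 ≡⟨ cong (λ s → (y ^ p + s) + x ^ p)
                                                      (trans (sum-cong-≗ middle≡0) (sum-replicate-zero n)) ⟩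
    (y ^ p + 0#) + x ^ p                         ≡⟨ cong (_+ x ^ p) (+-identityʳ _) ⟩
    y ^ p + x ^ p                                ≡⟨ +-comm _ _ ⟩
    x ^ p + y ^ p                                ∎
    where
    p = suc n
    t = binomialTerm x y p
    middle : Fin n → Carrier
    middle i = t (inject₁ (Fin.suc i))
    first : t Fin.zero ≡ y ^ p
    first = trans (+-identityʳ _) (*-identityˡ _)
    last : t (fromℕ p) ≡ x ^ p
    last = begin
      (p C toℕ (fromℕ p)) ×ⁿ (x ^ toℕ (fromℕ p) * y ^ (p ℕ.∸ toℕ (fromℕ p)))
        ≡⟨ cong (λ k → (p C k) ×ⁿ (x ^ k * y ^ (p ℕ.∸ k))) (Fin.toℕ-fromℕ p) ⟩
      (p C p) ×ⁿ (x ^ p * y ^ (p ℕ.∸ p))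
        ≡⟨ cong₂ (λ c k → c ×ⁿ (x ^ p * y ^ k)) (nCn≡1 p) (ℕ.n∸n≡0 p) ⟩
      x ^ p * 1# + 0#
        ≡⟨ trans (+-identityʳ _) (*-identityʳ _) ⟩
      x ^ p ∎
    middle≡0 : ∀ i → middle i ≡ 0#
    middle≡0 i = ∣⇒×ⁿ≡0 p×1≡0
      (prime∣C p-prime (toℕ (inject₁ i)) (subst (_< n) (sym (Fin.toℕ-inject₁ i)) (Fin.toℕ<n i))) _

  frobenius-^-+ : ∀ {p} → Prime p → p ×ⁿ 1# ≡ 0# → ∀ k x y →
    (x + y) ^ (p ℕ.^ k) ≡ x ^ (p ℕ.^ k) + y ^ (p ℕ.^ k)
  frobenius-^-+ p-prime p×1≡0 zero    x y =
    trans (*-identityʳ _) (sym (cong₂ _+_ (*-identityʳ x) (*-identityʳ y)))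
  frobenius-^-+ {p} p-prime p×1≡0 (suc k) x y = begin
    (x + y) ^ (p ℕ.* r)         ≡⟨ ^-assocʳ (x + y) p r ⟨
    ((x + y) ^ p) ^ r           ≡⟨ cong (_^ r) (frobenius-+ p-prime p×1≡0 x y) ⟩
    (x ^ p + y ^ p) ^ r         ≡⟨ frobenius-^-+ p-prime p×1≡0 k (x ^ p) (y ^ p) ⟩
    (x ^ p) ^ r + (y ^ p) ^ r   ≡⟨ cong₂ _+_ (^-assocʳ x p r) (^-assocʳ y p r) ⟩
    x ^ (p ℕ.* r) + y ^ (p ℕ.* r) ∎
    where r = p ℕ.^ k

  -- A field has no zero divisors, and p^k · 1 is the k-th power of p · 1. This leads from q · 1 = 0
  -- to the characteristic p.
  ^×1≡0 : ∀ p k → (p ℕ.^ k) ×ⁿ 1# ≡ 0# → p ×ⁿ 1# ≡ 0#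
  ^×1≡0 p zero    eq = contradiction (trans (sym (+-identityʳ 1#)) eq) 1≢0
  ^×1≡0 p (suc k) eq = [ id , ^×1≡0 p k ]′ (integral (trans (sym (×1-homo-* p (p ℕ.^ k))) eq))

-- The subfield F_q of the field with q² elements.

-- A subfield is a list, so that the same sums serve for F_q, where the points of the subplane are
-- counted, and for F itself, where tangents are counted.
record IsSubfield (F : FiniteField) (L : List (FiniteField.Carrier F)) : Set where
  open FieldProperties F
  field
    L-unique : Unique L
    0∈       : 0# ∈ L
    1∈       : 1# ∈ L
    +-∈      : ∀ {x y} → x ∈ L → y ∈ L → (x + y) ∈ L
    *-∈      : ∀ {x y} → x ∈ L → y ∈ L → (x * y) ∈ L
    -‿∈      : ∀ {x} → x ∈ L → (- x) ∈ L
    ⁻¹-∈     : ∀ {x} → x ∈ L → x ≢0 → (x ⁻¹) ∈ L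

wholeField : (F : FiniteField) → IsSubfield F (FiniteField.elements F)
wholeField F = record
  { L-unique = unique ; 0∈ = complete _ ; 1∈ = complete _ ; +-∈ = λ _ _ → complete _
  ; *-∈ = λ _ _ → complete _ ; -‿∈ = λ _ → complete _ ; ⁻¹-∈ = λ _ _ → complete _ }
  where open FiniteField F

module QuadraticExtension (F : FiniteField) (q : ℕ) (q-primePower : IsPrimePower q) (q-odd : OddNat q)
  (order≡q² : FiniteField.order F ≡ q ℕ.* q) where

  open FieldProperties F
  open Frobenius F
  open ≡-Reasoning
  private module PG = PlaneGeometry F q

  q×1≡0 : q ×ⁿ 1# ≡ 0#
  q×1≡0 = [ id , id ]′ (integral
    (trans (sym (×1-homo-* q q)) (subst (λ n → n ×ⁿ 1# ≡ 0#) order≡q² order×1≡0)))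

  ^q-+ : ∀ x y → (x + y) ^ q ≡ x ^ q + y ^ q
  ^q-+ x y = let p , k , p-prime , q≡p^ = q-primePower in subst (λ n → (x + y) ^ n ≡ x ^ n + y ^ n) (sym q≡p^)
    (frobenius-^-+ p-prime (^×1≡0 p (suc k) (subst (λ n → n ×ⁿ 1# ≡ 0#) q≡p^ q×1≡0)) (suc k) x y)

  -- (q - 1)/2; hence q - 1 appears as `j * 2` and (q + 1)/2 as `suc j`.
  j : ℕ
  j = q / 2

  q≡1+j*2 : q ≡ suc (j ℕ.* 2)
  q≡1+j*2 = trans (m≡m%n+[m/n]*n q 2) (cong (ℕ._+ j ℕ.* 2) q-odd)

  -- As q is odd, 2 = 0 would make q · 1 equal to 1, but it is 0.
  2≢0 : (1# + 1#) ≢0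
  2≢0 2≡0 = 1≢0 (begin
    1#                                        ≡⟨ +-identityʳ 1# ⟨
    1# + 0#                                   ≡⟨ cong (1# +_) (∣⇒×ⁿ≡0 (trans (cong (1# +_) (+-identityʳ 1#)) 2≡0)
                                                  (divides j refl) 1#) ⟨
    suc (j ℕ.* 2) ×ⁿ 1#                       ≡⟨ cong (_×ⁿ 1#) q≡1+j*2 ⟨
    q ×ⁿ 1#                                   ≡⟨ q×1≡0 ⟩
    0#                                        ∎)

  -- Euler's exponent (q² - 1)/2, factored as (q - 1) · (q + 1)/2. It is written so that x^h can be
  -- read as the (q + 1)/2-th power of x^(q-1).
  h : ℕ
  h = (j ℕ.* 2) ℕ.* suc j

  length-nonzeros : length nonzeros ≡ h ℕ.* 2
  length-nonzeros = ℕ.suc-injective (begin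
    suc (length nonzeros)            ≡⟨ suc-length-nonzeros ⟩
    order                            ≡⟨ order≡q² ⟩
    q ℕ.* q                          ≡⟨ cong₂ ℕ._*_ q≡1+j*2 q≡1+j*2 ⟩
    suc (j ℕ.* 2) ℕ.* suc (j ℕ.* 2)  ≡⟨ ℕ-solve 1 (λ j → (ℕ-con 1 ⊕ j ⊗ ℕ-con 2) ⊗ (ℕ-con 1 ⊕ j ⊗ ℕ-con 2)
                                          ⊜ ℕ-con 1 ⊕ ((j ⊗ ℕ-con 2) ⊗ (ℕ-con 1 ⊕ j)) ⊗ ℕ-con 2) refl j ⟩
    suc (h ℕ.* 2)                    ∎)
    where open +-*-Solver using () renaming (solve to ℕ-solve; con to ℕ-con; _:+_ to _⊕_; _:*_ to _⊗_; _:=_ to _⊜_)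

  x^q²≡x : ∀ x → x ^ (q ℕ.* q) ≡ x
  x^q²≡x x with x ≟ 0#
  ... | yes refl = subst (λ n → 0# ^ n ≡ 0#) (trans suc-length-nonzeros order≡q²) (zeroˡ _)
  ... | no x≢0   = begin
    x ^ (q ℕ.* q)            ≡⟨ cong (x ^_) (trans suc-length-nonzeros order≡q²) ⟨
    x * x ^ length nonzeros  ≡⟨ cong (x *_) (fermat x≢0) ⟩
    x * 1#                   ≡⟨ *-identityʳ x ⟩
    x                        ∎

  ^-PG : ∀ x n → x PG.^ n ≡ x ^ n
  ^-PG x zero    = refl
  ^-PG x (suc n) = cong (x *_) (^-PG x n)

  Fq : List Carrier
  Fq = filterᵇ PG.inFq elements

  inFq⁺ : ∀ {x} → x ^ q ≡ x → PG.inFq x ≡ true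
  inFq⁺ {x} eq = ≡⇒== (trans (^-PG x q) eq)

  inFq⁻ : ∀ {x} → PG.inFq x ≡ true → x ^ q ≡ x
  inFq⁻ {x} eq = trans (sym (^-PG x q)) (==⇒≡ eq)

  ∈Fq⁺ : ∀ {x} → x ^ q ≡ x → x ∈ Fq
  ∈Fq⁺ {x} eq = ∈-filterᵇ⁺ PG.inFq (complete x) (inFq⁺ eq)

  ∈Fq⁻ : ∀ {x} → x ∈ Fq → x ^ q ≡ x
  ∈Fq⁻ x∈ = inFq⁻ (proj₂ (∈-filterᵇ⁻ PG.inFq elements x∈))

  0^q≡0 : 0# ^ q ≡ 0#
  0^q≡0 = subst (λ n → 0# ^ n ≡ 0#) (sym q≡1+j*2) (zeroˡ _)

  Fq-isSubfield : IsSubfield F Fq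
  Fq-isSubfield = record
    { L-unique = filterᵇ-Unique PG.inFq unique
    ; 0∈       = ∈Fq⁺ 0^q≡0
    ; 1∈       = ∈Fq⁺ (1^n≡1 q)
    ; +-∈      = λ {x} {y} x∈ y∈ → ∈Fq⁺ (trans (^q-+ x y) (cong₂ _+_ (∈Fq⁻ x∈) (∈Fq⁻ y∈)))
    ; *-∈      = λ {x} {y} x∈ y∈ → ∈Fq⁺ (trans (^-distrib-* x y q) (cong₂ _*_ (∈Fq⁻ x∈) (∈Fq⁻ y∈)))
    ; -‿∈      = λ {x} x∈ → ∈Fq⁺ (trans (x+y≡0⇒y≡-x (x ^ q) _ (begin
        x ^ q + (- x) ^ q   ≡⟨ ^q-+ x (- x) ⟨
        (x + - x) ^ q       ≡⟨ cong (_^ q) (-‿inverseʳ x) ⟩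
        0# ^ q              ≡⟨ 0^q≡0 ⟩
        0#                  ∎)) (cong -_ (∈Fq⁻ x∈)))
    ; ⁻¹-∈     = λ {x} x∈ x≢0 → ∈Fq⁺ (*-cancelˡ x≢0 (begin
        x * (x ⁻¹) ^ q        ≡⟨ cong (_* (x ⁻¹) ^ q) (∈Fq⁻ x∈) ⟨
        x ^ q * (x ⁻¹) ^ q    ≡⟨ ^-distrib-* x (x ⁻¹) q ⟨
        (x * x ⁻¹) ^ q        ≡⟨ cong (_^ q) (⁻¹-inverseʳ x≢0) ⟩
        1# ^ q                ≡⟨ 1^n≡1 q ⟩
        1#                    ≡⟨ ⁻¹-inverseʳ x≢0 ⟨
        x * x ⁻¹              ∎))
    }
  open IsSubfield Fq-isSubfield

  ∈Fq⇒^j*2≡1 : ∀ {x} → x ∈ Fq → x ≢0 → x ^ (j ℕ.* 2) ≡ 1#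
  ∈Fq⇒^j*2≡1 {x} x∈ x≢0 = *-cancelˡ x≢0 (begin
    x ^ suc (j ℕ.* 2)   ≡⟨ cong (x ^_) q≡1+j*2 ⟨
    x ^ q               ≡⟨ ∈Fq⁻ x∈ ⟩
    x                   ≡⟨ *-identityʳ x ⟨
    x * 1#              ∎)

  private
    Fq* : List Carrier
    Fq* = filterᵇ (λ x → not (x == 0#)) Fq

    suc-length-Fq* : suc (length Fq*) ≡ length Fq
    suc-length-Fq* = trans (cong suc (length-filterᵇ _ Fq)) (∑-nonzero Fq L-unique 0∈)

  module _ (0<j : 0 < j) where

    private
      j*2≡suc : ∃ λ k → j ℕ.* 2 ≡ suc k
      j*2≡suc = _ , sym (ℕ.suc-pred (j ℕ.* 2) ⦃ ℕ.>-nonZero (ℕ.*-mono-≤ {1} {j} {1} {2} 0<j (s≤s z≤n)) ⦄)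

    -- At least: the norm x ↦ x^(q+1) maps the units of F to those of F_q, with fibres of at most q + 1 elements.
    length-Fq : length Fq ≡ q
    length-Fq = trans (sym suc-length-Fq*) (trans (cong suc (ℕ.≤-antisym upper lower)) (sym q≡1+j*2))
      where
      upper : length Fq* ≤ j ℕ.* 2
      upper with k , eq ← j*2≡suc = subst (length Fq* ≤_) (sym eq) (power-roots-≤ k 1# (filterᵇ-Unique _ L-unique)
        λ {x} x∈ → let x∈Fq , nz = ∈-filterᵇ⁻ _ Fq x∈ in
          subst (λ n → x ^ n ≡ 1#) eq (∈Fq⇒^j*2≡1 x∈Fq (nonzero-test nz)))

      norm∈ : ∀ x → x ∈ nonzeros → (x ^ suc q) ∈ Fq*
      norm∈ x x∈ = ∈-filterᵇ⁺ _ (∈Fq⁺ (begin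
        (x * x ^ q) ^ q           ≡⟨ ^-distrib-* x (x ^ q) q ⟩
        x ^ q * (x ^ q) ^ q       ≡⟨ cong (x ^ q *_) (trans (^-assocʳ x q q) (x^q²≡x x)) ⟩
        x ^ q * x                 ≡⟨ *-comm _ x ⟩
        x * x ^ q                 ∎)) (cong not (≢⇒== (^-≢0 (∈-nonzeros⁻ x∈) (suc q))))

      lower : j ℕ.* 2 ≤ length Fq*
      lower = ℕ.*-cancelʳ-≤ (j ℕ.* 2) (length Fq*) (suc q) (subst (_≤ length Fq* ℕ.* suc q)
        (trans length-nonzeros h*2≡)
        (length-≤-fibres _≟_ (_^ suc q) nonzeros Fq* (suc q) norm∈ λ c →
          subst (_≤ suc q) (length-filterᵇ _ nonzeros)
            (power-roots-≤ q c (filterᵇ-Unique _ nonzeros-Unique)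
              λ x∈ → ==⇒≡ (proj₂ (∈-filterᵇ⁻ (λ x → x ^ suc q == c) nonzeros x∈)))))
        where
        h*2≡ : h ℕ.* 2 ≡ (j ℕ.* 2) ℕ.* suc q
        h*2≡ = trans (ℕ.*-assoc (j ℕ.* 2) (suc j) 2) (cong (λ n → (j ℕ.* 2) ℕ.* suc n) (sym q≡1+j*2))

    -- Euler's criterion in F holds for every unit of F_q, because `h` is a multiple of q - 1.
    ∈Fq⇒IsSquare : ∀ {x} → x ∈ Fq → IsSquare x
    ∈Fq⇒IsSquare {x} x∈ with x ≟ 0#
    ... | yes refl = 0# , zeroˡ 0#
    ... | no  x≢0  = ^h≡1⇒square h length-nonzeros (ℕ.*-mono-≤ {1} {j ℕ.* 2} (ℕ.*-mono-≤ 0<j (s≤s z≤n)) (s≤s z≤n))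
      x≢0 (begin
        x ^ h                      ≡⟨ ^-assocʳ x (j ℕ.* 2) (suc j) ⟨
        (x ^ (j ℕ.* 2)) ^ suc j    ≡⟨ cong (_^ suc j) (∈Fq⇒^j*2≡1 x∈ x≢0) ⟩
        1# ^ suc j                 ≡⟨ 1^n≡1 (suc j) ⟩
        1#                         ∎)

  -- For u ∉ F_q the map z ↦ (z + u)^(q−1) = (z + u^q) / (z + u) is injective on F_q, and on the
  -- set counted here all its values are roots of the same polynomial X^((q+1)/2) − c^h.
  count-squares-≤ : ∀ {c u} → ¬ (u ∈ Fq) → ∑[ z ← Fq ] 𝟙 (isNonzeroSquare (c * (z + u))) ≤ suc j
  count-squares-≤ {c} {u} u∉ = subst (_≤ suc j) (trans (length-map φ S) (length-filterᵇ test Fq))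
    (power-roots-≤ j (c ^ h) (Unique-map-∈ φ φ-injective (filterᵇ-Unique test L-unique)) λ y∈ →
      let z , z∈ , y≡ = ∈-map⁻ φ y∈ in trans (cong (_^ suc j) y≡) (φ-root z z∈))
    where
    test : Carrier → Bool
    test z = isNonzeroSquare (c * (z + u))
    S : List Carrier
    S = filterᵇ test Fq
    φ : Carrier → Carrier
    φ z = (z + u) ^ (j ℕ.* 2)

    φ-root : ∀ z → z ∈ S → φ z ^ suc j ≡ c ^ h
    φ-root z z∈ with nz , sq ← isNonzeroSquare⁻ (proj₂ (∈-filterᵇ⁻ test Fq z∈)) =
      *-cancelˡ (^-≢0 c≢0 h) (begin
        c ^ h * φ z ^ suc j        ≡⟨ cong (c ^ h *_) (^-assocʳ (z + u) (j ℕ.* 2) (suc j)) ⟩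
        c ^ h * (z + u) ^ h        ≡⟨ ^-distrib-* c (z + u) h ⟨
        (c * (z + u)) ^ h          ≡⟨ square⇒^h≡1 h length-nonzeros nz sq ⟩
        -- The nonzero square c² satisfies Euler's criterion too, so c^h is its own inverse and the
        -- condition on z + u becomes an equation with right-hand side c^h.
        1#                         ≡⟨ square⇒^h≡1 h length-nonzeros (*-≢0 c≢0 c≢0) (c , refl) ⟨
        (c * c) ^ h                ≡⟨ ^-distrib-* c c h ⟩
        c ^ h * c ^ h              ∎)
      where
      c≢0 : c ≢0
      c≢0 = *-≢0⁻ˡ nz

    φ-injective : ∀ {z z′} → z ∈ S → z′ ∈ S → φ z ≡ φ z′ → z ≡ z′
    φ-injective {z} {z′} z∈S z′∈S φz≡φz′ =
      [ x-y≡0⇒x≡y , (λ u-uᵠ≡0 → contradiction (∈Fq⁺ (sym (x-y≡0⇒x≡y u-uᵠ≡0))) u∉) ]′ (integral (begin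
        (z + - z′) * (u + - (u ^ q))
          -- The map x ↦ (x + v)/(x + u) is a Möbius transformation of determinant u - v; this is
          -- its injectivity with the denominators cleared.
          ≡⟨ solve 4 (λ z z′ u v → (z :- z′) :* (u :- v) := (z :+ v) :* (z′ :+ u) :- (z′ :+ v) :* (z :+ u))
               refl z z′ u (u ^ q) ⟩
        (z + u ^ q) * (z′ + u) + - ((z′ + u ^ q) * (z + u))
          ≡⟨ cong₂ (λ s t → s * (z′ + u) + - (t * (z + u))) (conj z∈S) (conj z′∈S) ⟩
        ((z + u) * φ z) * (z′ + u) + - (((z′ + u) * φ z′) * (z + u))
          ≡⟨ cong (λ t → ((z + u) * t) * (z′ + u) + - (((z′ + u) * φ z′) * (z + u))) φz≡φz′ ⟩
        ((z + u) * φ z′) * (z′ + u) + - (((z′ + u) * φ z′) * (z + u))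
          ≡⟨ solve 3 (λ a b f → (a :* f) :* b :- (b :* f) :* a := :0) refl (z + u) (z′ + u) (φ z′) ⟩
        0# ∎))
      where
      conj : ∀ {x} → x ∈ S → x + u ^ q ≡ (x + u) * φ x
      conj {x} x∈ = begin
        x + u ^ q                 ≡⟨ cong (_+ u ^ q) (∈Fq⁻ (proj₁ (∈-filterᵇ⁻ test Fq x∈))) ⟨
        x ^ q + u ^ q             ≡⟨ ^q-+ x u ⟨
        (x + u) ^ q               ≡⟨ cong ((x + u) ^_) q≡1+j*2 ⟩
        (x + u) ^ suc (j ℕ.* 2)   ∎

-- Sums over projective points by way of sums over vectors.

module ProjectiveSums (F : FiniteField) {L : List (FiniteField.Carrier F)} (L-sub : IsSubfield F L) where

  open FieldProperties F
  open IsSubfield L-sub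
  open ≡-Reasoning

  ∑² : (Carrier → Carrier → ℕ) → ℕ
  ∑² g = ∑[ y ← L ] ∑[ z ← L ] g y z

  ∑³ : (Carrier → Carrier → Carrier → ℕ) → ℕ
  ∑³ f = ∑[ x ← L ] ∑² (f x)

  ∑ℙ¹ : (Carrier → Carrier → ℕ) → ℕ
  ∑ℙ¹ g = ∑[ z ← L ] g 1# z ℕ.+ g 0# 1#

  -- The summands follow the normal forms of `projPoints`; splitting off the part with first
  -- coordinate 1 leaves a projective line, which allows induction on the dimension.
  ∑ℙ² : (Carrier → Carrier → Carrier → ℕ) → ℕ
  ∑ℙ² f = ∑² (f 1#) ℕ.+ ∑ℙ¹ (f 0#)

  ∑²-cong : ∀ {g g′} → (∀ y z → y ∈ L → z ∈ L → g y z ≡ g′ y z) → ∑² g ≡ ∑² g′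
  ∑²-cong h = ∑-cong-∈ L λ y y∈ → ∑-cong-∈ L λ z → h y z y∈

  ∑³-cong : ∀ {f f′} → (∀ x y z → x ∈ L → y ∈ L → z ∈ L → f x y z ≡ f′ x y z) → ∑³ f ≡ ∑³ f′
  ∑³-cong h = ∑-cong-∈ L λ x x∈ → ∑²-cong λ y z → h x y z x∈

  ∑-scale : ∀ {c} → c ∈ L → c ≢0 → ∀ f → ∑[ x ← L ] f (c * x) ≡ ∑ L f
  ∑-scale {c} c∈ c≢0 f = ∑-reindex f (c *_) (c ⁻¹ *_) L-unique
    (*-∈ c∈) (*-∈ (⁻¹-∈ c∈ c≢0)) (⁻¹-cancelˡ c≢0) (⁻¹-cancelʳ c≢0)

  ∑-shift : ∀ {c} → c ∈ L → ∀ f → ∑[ x ← L ] f (x + c) ≡ ∑ L f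
  ∑-shift {c} c∈ f = ∑-reindex f (_+ c) (_+ - c) L-unique
    (λ x∈ → +-∈ x∈ c∈) (λ x∈ → +-∈ x∈ (-‿∈ c∈))
    (λ x → solve 2 (λ x c → (x :+ c) :- c := x) refl x c)
    (λ x → solve 2 (λ x c → (x :- c) :+ c := x) refl x c)

  Homogeneous² : (Carrier → Carrier → ℕ) → Set
  Homogeneous² g = ∀ c y z → c ≢0 → g (c * y) (c * z) ≡ g y z

  Homogeneous³ : (Carrier → Carrier → Carrier → ℕ) → Set
  Homogeneous³ f = ∀ c x y z → c ≢0 → f (c * x) (c * y) (c * z) ≡ f x y z

  n : ℕ
  n = length L

  private
    all-but-0 : ∀ (H : Carrier → ℕ) → (∀ x → x ∈ L → x ≢0 → H x ≡ H 1#) →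
      ∑ L H ℕ.+ H 1# ≡ H 0# ℕ.+ n ℕ.* H 1#
    all-but-0 H = ∑-all-but-one L L-unique 0∈

    combine : ∀ {v g w k m} → v ℕ.+ k ≡ g ℕ.+ n ℕ.* k → g ℕ.+ m ≡ w ℕ.+ n ℕ.* m →
      v ℕ.+ (k ℕ.+ m) ≡ w ℕ.+ n ℕ.* (k ℕ.+ m)
    combine {v} {g} {w} {k} {m} eq₁ eq₂ = begin
      v ℕ.+ (k ℕ.+ m)                       ≡⟨ ℕ.+-assoc v k m ⟨
      v ℕ.+ k ℕ.+ m                         ≡⟨ cong (ℕ._+ m) eq₁ ⟩
      g ℕ.+ n ℕ.* k ℕ.+ m                   ≡⟨ +-*-Solver.solve 3 (λ g nk m → g ⊕ nk ⊕ m ⊜ g ⊕ m ⊕ nk) refl g (n ℕ.* k) m ⟩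
      g ℕ.+ m ℕ.+ n ℕ.* k                   ≡⟨ cong (ℕ._+ n ℕ.* k) eq₂ ⟩
      w ℕ.+ n ℕ.* m ℕ.+ n ℕ.* k             ≡⟨ +-*-Solver.solve 4 (λ w n k m →
        w ⊕ n ⊗ m ⊕ n ⊗ k ⊜ w ⊕ n ⊗ (k ⊕ m)) refl w n k m ⟩
      w ℕ.+ n ℕ.* (k ℕ.+ m)                 ∎
      where open +-*-Solver using () renaming (_:+_ to _⊕_; _:*_ to _⊗_; _:=_ to _⊜_)

  -- Every point has n - 1 nonzero representatives, all with the same value, and the zero vector is
  -- added separately. One copy of the projective sum is moved to the left to avoid subtraction.
  ∑²-∑ℙ¹ : ∀ g → Homogeneous² g → ∑² g ℕ.+ ∑ℙ¹ g ≡ g 0# 0# ℕ.+ n ℕ.* ∑ℙ¹ g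
  ∑²-∑ℙ¹ g hom = combine
    (all-but-0 (λ y → ∑ L (g y)) λ y y∈ y≢0 → begin
      ∑[ z ← L ] g y z               ≡⟨ ∑-scale y∈ y≢0 (g y) ⟨
      ∑[ z ← L ] g y (y * z)         ≡⟨ ∑-cong L (λ z → trans (cong (λ t → g t (y * z)) (sym (*-identityʳ y)))
                                                             (hom y 1# z y≢0)) ⟩
      ∑[ z ← L ] g 1# z              ∎)
    (all-but-0 (g 0#) λ z _ z≢0 →
      trans (cong₂ g (sym (zeroʳ z)) (sym (*-identityʳ z))) (hom z 0# 1# z≢0))

  ∑³-∑ℙ² : ∀ f → Homogeneous³ f → ∑³ f ℕ.+ ∑ℙ² f ≡ f 0# 0# 0# ℕ.+ n ℕ.* ∑ℙ² f
  ∑³-∑ℙ² f hom = combine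
    (all-but-0 (λ x → ∑² (f x)) λ x x∈ x≢0 → begin
      ∑[ y ← L ] ∑[ z ← L ] f x y z              ≡⟨ ∑-scale x∈ x≢0 (λ y → ∑ L (f x y)) ⟨
      ∑[ y ← L ] ∑[ z ← L ] f x (x * y) z        ≡⟨ ∑-cong L (λ y → sym (∑-scale x∈ x≢0 (f x (x * y)))) ⟩
      ∑[ y ← L ] ∑[ z ← L ] f x (x * y) (x * z)  ≡⟨ ∑²-cong (λ y z _ _ →
        trans (cong (λ t → f t (x * y) (x * z)) (sym (*-identityʳ x))) (hom x 1# y z x≢0)) ⟩
      ∑[ y ← L ] ∑[ z ← L ] f 1# y z             ∎)
    (∑²-∑ℙ¹ (f 0#) λ c y z c≢0 → trans (cong (λ t → f t (c * y) (c * z)) (sym (zeroʳ c))) (hom c 0# y z c≢0))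

  2≤n : 2 ≤ n
  2≤n = Unique-⊆⇒length-≤ {xs = 0# ∷ 1# ∷ []} ((0≢1 ∷ []) ∷ [] ∷ []) λ where
    (here refl)         → 0∈
    (there (here refl)) → 1∈

  -- Cancelling one copy of p leaves v = w + (n - 1) · p with n - 1 positive. So equal vector sums
  -- give equal point counts, even when the matching of vectors ignores normal forms.
  projective-count-unique : ∀ {v w p p′} → v ℕ.+ p ≡ w ℕ.+ n ℕ.* p → v ℕ.+ p′ ≡ w ℕ.+ n ℕ.* p′ → p ≡ p′
  projective-count-unique {v} {w} {p} {p′} eq eq′ = cancel 2≤n eq eq′
    where
    cancel : ∀ {n} → 2 ≤ n → v ℕ.+ p ≡ w ℕ.+ n ℕ.* p → v ℕ.+ p′ ≡ w ℕ.+ n ℕ.* p′ → p ≡ p′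
    cancel {suc (suc m)} (s≤s (s≤s _)) eq eq′ = ℕ.*-cancelˡ-≡ p p′ (suc m) (ℕ.+-cancelˡ-≡ w _ _
      (trans (sym (affine p eq)) (affine p′ eq′)))
      where
      affine : ∀ p → v ℕ.+ p ≡ w ℕ.+ suc (suc m) ℕ.* p → v ≡ w ℕ.+ suc m ℕ.* p
      affine p eq = ℕ.+-cancelʳ-≡ p _ _ (trans eq (+-*-Solver.solve 3 (λ w p r →
        w ⊕ (p ⊕ r) ⊜ w ⊕ r ⊕ p) refl w p (suc m ℕ.* p)))
        where open +-*-Solver using () renaming (_:+_ to _⊕_; _:=_ to _⊜_)

  ∑ℙ²-cong : ∀ {f f′} → (∀ y z → y ∈ L → z ∈ L → f 1# y z ≡ f′ 1# y z) →
    (∀ z → z ∈ L → f 0# 1# z ≡ f′ 0# 1# z) → f 0# 0# 1# ≡ f′ 0# 0# 1# → ∑ℙ² f ≡ ∑ℙ² f′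
  ∑ℙ²-cong h₁ h₂ h₃ = cong₂ ℕ._+_ (∑²-cong h₁) (cong₂ ℕ._+_ (∑-cong-∈ L h₂) h₃)

  ∑³-swap₂₃ : ∀ f → ∑³ f ≡ ∑³ (λ x y z → f x z y)
  ∑³-swap₂₃ f = ∑-cong L λ x → ∑-swap L L (f x)

  ∑³-swap₁₂ : ∀ f → ∑³ f ≡ ∑³ (λ x y z → f y x z)
  ∑³-swap₁₂ f = ∑-swap L L λ x y → ∑ L (f x y)

-- Zeros of binary quadratic forms.

-- Ties the number of zeros on a line to the quadratic character of the discriminant, so that either
-- can be read off from the other.
data Roots (F : FiniteField) (D : FiniteField.Carrier F) : ℕ → Set where
  one  : D ≡ FiniteField.0# F → Roots F D 1
  two  : ¬ (D ≡ FiniteField.0# F) → FieldProperties.IsSquare F D → Roots F D 2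
  none : ¬ FieldProperties.IsSquare F D → Roots F D 0

module Conics (F : FiniteField) (q : ℕ)
  (2≢0 : ¬ (FiniteField._+_ F (FiniteField.1# F) (FiniteField.1# F) ≡ FiniteField.0# F)) where

  open FieldProperties F
  open PlaneGeometry F q hiding (_^_; _==_)
  open ProjectiveSums F (wholeField F)
  open ≡-Reasoning

  binary : Carrier → Carrier → Carrier → Carrier → Carrier → Carrier
  binary α β γ y z = α * y * y + 2# * β * y * z + γ * z * z

  x≡-x⇒x≡0 : ∀ {x} → x ≡ - x → x ≡ 0#
  x≡-x⇒x≡0 {x} eq = [ (λ 2≡0 → contradiction 2≡0 2≢0) , id ]′ (integral (begin
    2# * x         ≡⟨ solve 1 (λ x → :2 :* x := x :+ x) refl x ⟩
    x + x          ≡⟨ cong (x +_) eq ⟩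
    x + - x        ≡⟨ -‿inverseʳ x ⟩
    0#             ∎))

  sq-roots : ∀ D → Roots F D (∑[ s ← elements ] 𝟙 (s * s == D))
  sq-roots D with isSquare? D
  ... | no ¬sq = subst (Roots F D) (sym (∑-zero elements λ s _ → cong 𝟙 (≢⇒== λ eq → ¬sq (s , eq)))) (none ¬sq)
  ... | yes (r , refl) with r ≟ 0#
  ...   | yes refl = subst (Roots F (0# * 0#)) (sym (trans
            (∑-only elements unique (complete 0#) λ s _ s≢0 → cong 𝟙 (≢⇒== λ eq →
              *-≢0 s≢0 s≢0 (trans eq (zeroˡ 0#))))
            (cong 𝟙 (≡⇒== {0# * 0#} refl)))) (one (zeroˡ 0#))
  ...   | no r≢0 = subst (Roots F (r * r)) (sym count≡2) (two (*-≢0 r≢0 r≢0) (r , refl))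
    where
    split : ∀ s → 𝟙 (s * s == r * r) ≡ 𝟙 (s == r) ℕ.+ 𝟙 (s == - r)
    split s with s ≟ r | s ≟ (- r)
    ... | yes refl | yes r≡-r = contradiction (x≡-x⇒x≡0 r≡-r) r≢0
    ... | yes refl | no _     = cong 𝟙 (≡⇒== {s * s} refl)
    ... | no  _    | yes refl = cong 𝟙 (≡⇒== (solve 1 (λ r → ⊝ r :* ⊝ r := r :* r) refl r))
    ... | no  s≢r  | no s≢-r  = cong 𝟙 (≢⇒== λ eq →
      [ s≢r ∘ x-y≡0⇒x≡y , s≢-r ∘ x+y≡0⇒x≡-y s r ]′ (integral (begin
        (s + - r) * (s + r)    ≡⟨ solve 2 (λ s r → (s :- r) :* (s :+ r) := s :* s :- r :* r) refl s r ⟩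
        s * s + - (r * r)      ≡⟨ cong (_+ - (r * r)) eq ⟩
        r * r + - (r * r)      ≡⟨ -‿inverseʳ (r * r) ⟩
        0#                     ∎)))
    count-1 : ∀ t → ∑[ s ← elements ] 𝟙 (s == t) ≡ 1
    count-1 t = trans (∑-only elements unique (complete t) λ s _ s≢t → cong 𝟙 (≢⇒== s≢t))
      (cong 𝟙 (≡⇒== {t} refl))
    count≡2 : ∑[ s ← elements ] 𝟙 (s * s == r * r) ≡ 2
    count≡2 = trans (∑-cong elements split) (trans (∑-distrib-+ elements _ _)
      (cong₂ ℕ._+_ (count-1 r) (count-1 (- r))))

  -- For γ ≠ 0 the point (0 : 1) is not a zero, and multiplying by γ completes the square. For γ = 0
  -- the point (0 : 1) is a zero, and the remaining factor αy + 2βz has a second zero exactly when β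
  -- ≠ 0.
  binary-roots : ∀ α β γ → ¬ (α ≡ 0# × β ≡ 0# × γ ≡ 0#) →
    Roots F (β * β + - (α * γ)) (∑ℙ¹ λ y z → 𝟙 (binary α β γ y z == 0#))
  binary-roots α β γ nonzero with γ ≟ 0#
  ... | no γ≢0 = subst (Roots F D) (sym (begin
      ∑[ t ← elements ] 𝟙 (binary α β γ 1# t == 0#) ℕ.+ 𝟙 (binary α β γ 0# 1# == 0#)
        ≡⟨ cong₂ ℕ._+_ (∑-cong elements (λ t → cong 𝟙 (⇔⇒≡ (≡⇒== ∘ complete-square⁺ t ∘ ==⇒≡)
                                                              (≡⇒== ∘ complete-square⁻ t ∘ ==⇒≡))))
                       (cong 𝟙 (≢⇒== λ eq → γ≢0 (trans (sym binary01) eq))) ⟩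
      ∑[ t ← elements ] 𝟙 ((γ * t + β) * (γ * t + β) == D) ℕ.+ 0
        ≡⟨ ℕ.+-identityʳ _ ⟩
      ∑[ t ← elements ] 𝟙 ((γ * t + β) * (γ * t + β) == D)
        ≡⟨ ∑-scale (complete γ) γ≢0 (λ s → 𝟙 ((s + β) * (s + β) == D)) ⟩
      ∑[ s ← elements ] 𝟙 ((s + β) * (s + β) == D)
        ≡⟨ ∑-shift (complete β) (λ s → 𝟙 (s * s == D)) ⟩
      ∑[ s ← elements ] 𝟙 (s * s == D) ∎)) (sq-roots D)
    where
    D = β * β + - (α * γ)
    binary01 : binary α β γ 0# 1# ≡ γ
    binary01 = solve 3 (λ α β γ → α :* :0 :* :0 :+ :2 :* β :* :0 :* :1
      :+ γ :* :1 :* :1 := γ) refl α β γ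
    square : ∀ t → γ * binary α β γ 1# t ≡ (γ * t + β) * (γ * t + β) + - D
    square = solve 4 (λ α β γ t → γ :* (α :* :1 :* :1 :+ :2 :* β :* :1 :* t :+ γ :* t :* t)
      := (γ :* t :+ β) :* (γ :* t :+ β) :- (β :* β :- α :* γ)) refl α β γ
    complete-square⁺ : ∀ t → binary α β γ 1# t ≡ 0# → (γ * t + β) * (γ * t + β) ≡ D
    complete-square⁺ t eq = x-y≡0⇒x≡y (trans (sym (square t)) (trans (cong (γ *_) eq) (zeroʳ γ)))
    complete-square⁻ : ∀ t → (γ * t + β) * (γ * t + β) ≡ D → binary α β γ 1# t ≡ 0#
    complete-square⁻ t eq = [ (λ γ≡0 → contradiction γ≡0 γ≢0) , id ]′
      (integral (trans (square t) (trans (cong (_+ - D) eq) (-‿inverseʳ D))))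
  ... | yes refl with β ≟ 0#
  ...   | yes refl = subst (Roots F (0# * 0# + - (α * 0#))) (sym (cong₂ ℕ._+_
            (∑-zero elements λ t _ → cong 𝟙 (≢⇒== λ eq → nonzero (trans (sym (at1 t)) eq , refl , refl)))
            (cong 𝟙 (≡⇒== (solve 1 (λ α → α :* :0 :* :0 :+ :2 :* :0 :* :0 :* :1
              :+ :0 :* :1 :* :1 := :0) refl α)))))
            (one (solve 1 (λ α → :0 :* :0 :- α :* :0 := :0) refl α))
    where
    at1 : ∀ t → binary α 0# 0# 1# t ≡ α
    at1 = solve 2 (λ α t → α :* :1 :* :1 :+ :2 :* :0 :* :1 :* t
      :+ :0 :* t :* t := α) refl α
  ...   | no β≢0 = subst (Roots F (β * β + - (α * 0#))) (sym (cong₂ ℕ._+_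
            (trans (∑-only elements unique (complete r) λ t _ t≢r → cong 𝟙 (≢⇒== λ eq →
                     t≢r (*-cancelˡ 2β≢0 (+-cancelˡ α _ _ (trans (sym (at1 t)) (trans eq (trans (sym root) (at1 r))))))))
                   (cong 𝟙 (≡⇒== root)))
            (cong 𝟙 (≡⇒== (solve 2 (λ α β → α :* :0 :* :0 :+ :2 :* β :* :0 :* :1
              :+ :0 :* :1 :* :1 := :0) refl α β)))))
            (two (λ D≡0 → *-≢0 β≢0 β≢0 (trans ββ≡D D≡0)) (β , ββ≡D))
    where
    ββ≡D : β * β ≡ β * β + - (α * 0#)
    ββ≡D = solve 2 (λ α β → β :* β := β :* β :- α :* :0) refl α β
    2β≢0 : (2# * β) ≢0
    2β≢0 = *-≢0 2≢0 β≢0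
    r : Carrier
    r = (2# * β) ⁻¹ * - α
    at1 : ∀ t → binary α β 0# 1# t ≡ α + (2# * β) * t
    at1 = solve 3 (λ α β t → α :* :1 :* :1 :+ :2 :* β :* :1 :* t
      :+ :0 :* t :* t := α :+ (:2 :* β) :* t) refl α β
    root : binary α β 0# 1# r ≡ 0#
    root = trans (at1 r) (trans (cong (α +_) (⁻¹-cancelʳ 2β≢0 (- α))) (-‿inverseʳ α))

-- Tangent lines, the dual conic and the discriminant of a point.

module Tangents (F : FiniteField) (q : ℕ)
  (2≢0 : ¬ (FiniteField._+_ F (FiniteField.1# F) (FiniteField.1# F) ≡ FiniteField.0# F)) where

  open FieldProperties F
  open PlaneGeometry F q hiding (_^_; _==_)
  open ProjectiveSums F (wholeField F)
  open Conics F q 2≢0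
  open ≡-Reasoning

  -- The cofactors of the symmetric matrix, that is the dual conic: for irreducible `C` its form
  -- vanishes exactly at the tangents.
  adjugate : Conic → Conic
  adjugate (conic a b c d e f) = conic (b * c + - (f * f)) (a * c + - (e * e)) (a * b + - (d * d))
    (e * f + - (c * d)) (d * f + - (b * e)) (d * e + - (a * f))

  :form : ∀ {n} (a b c d e f x y z : Polynomial n) → Polynomial n
  :form a b c d e f x y z = a :* x :* x :+ b :* y :* y :+ c :* z :* z
    :+ :2 :* d :* x :* y :+ :2 :* e :* x :* z :+ :2 :* f :* y :* z

  :det : ∀ {n} (a b c d e f : Polynomial n) → Polynomial n
  :det a b c d e f = a :* b :* c :+ :2 :* d :* e :* f :- (a :* f :* f) :- (b :* e :* e) :- (c :* d :* d)

  :binary : ∀ {n} (α β γ y z : Polynomial n) → Polynomial n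
  :binary α β γ y z = α :* y :* y :+ :2 :* β :* y :* z :+ γ :* z :* z

  :A* :B* :C* : ∀ {n} (p q r : Polynomial n) → Polynomial n
  :A* b c f = b :* c :- f :* f
  :B* a c e = a :* c :- e :* e
  :C* a b d = a :* b :- d :* d

  :D* :E* :F* : ∀ {n} (p q r s : Polynomial n) → Polynomial n
  :D* c d e f = e :* f :- c :* d
  :E* b d e f = d :* f :- b :* e
  :F* a d e f = d :* e :- a :* f

  det-adjugate : ∀ C → det (adjugate C) ≡ det C * det C
  det-adjugate (conic a b c d e f) = solve 6 (λ a b c d e f →
    :det (:A* b c f) (:B* a c e) (:C* a b d) (:D* c d e f) (:E* b d e f) (:F* a d e f)
    := :det a b c d e f :* :det a b c d e f) refl a b c d e f

  -- The identity adj (adj M) = det M · M is checked entry by entry. Only then is the form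
  -- evaluated, with the determinant as a single variable δ, which keeps the expanded polynomials
  -- small.
  form-adjugate² : ∀ C P → form (adjugate (adjugate C)) P ≡ det C * form C P
  form-adjugate² C@(conic a b c d e f) (x , y , z) = trans
    (form-cong
      (solve 6 (λ a b c d e f → :B* a c e :* :C* a b d :- :F* a d e f :* :F* a d e f := :det a b c d e f :* a) refl a b c d e f)
      (solve 6 (λ a b c d e f → :A* b c f :* :C* a b d :- :E* b d e f :* :E* b d e f := :det a b c d e f :* b) refl a b c d e f)
      (solve 6 (λ a b c d e f → :A* b c f :* :B* a c e :- :D* c d e f :* :D* c d e f := :det a b c d e f :* c) refl a b c d e f)
      (solve 6 (λ a b c d e f → :E* b d e f :* :F* a d e f :- :C* a b d :* :D* c d e f := :det a b c d e f :* d) refl a b c d e f)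
      (solve 6 (λ a b c d e f → :D* c d e f :* :F* a d e f :- :B* a c e :* :E* b d e f := :det a b c d e f :* e) refl a b c d e f)
      (solve 6 (λ a b c d e f → :D* c d e f :* :E* b d e f :- :A* b c f :* :F* a d e f := :det a b c d e f :* f) refl a b c d e f))
    (solve 10 (λ δ a b c d e f x y z → :form (δ :* a) (δ :* b) (δ :* c) (δ :* d) (δ :* e) (δ :* f) x y z
      := δ :* :form a b c d e f x y z) refl (det C) a b c d e f x y z)
    where
    form-cong : ∀ {a a′ b b′ c c′ d d′ e e′ f f′} → a ≡ a′ → b ≡ b′ → c ≡ c′ → d ≡ d′ → e ≡ e′ → f ≡ f′ →
      form (conic a b c d e f) (x , y , z) ≡ form (conic a′ b′ c′ d′ e′ f′) (x , y , z)
    form-cong refl refl refl refl refl refl = refl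

  ∑-projPoints : ∀ (φ : Triple → ℕ) → ∑ projPoints φ ≡ ∑ℙ² (λ x y z → φ (x , y , z))
  ∑-projPoints φ = begin
    ∑ projPoints φ                       ≡⟨ ∑-++ affine _ φ ⟩
    ∑ affine φ ℕ.+ ∑ (infinite ++ _) φ
      ≡⟨ cong₂ ℕ._+_
           (trans (∑-concatMap _ φ elements) (∑-cong elements λ y → ∑-map _ φ elements))
           (trans (∑-++ infinite _ φ) (cong₂ ℕ._+_ (∑-map _ φ elements) (ℕ.+-identityʳ _))) ⟩
    ∑ℙ² (λ x y z → φ (x , y , z))        ∎
    where
    affine   = concatMap (λ y → map (λ z → (1# , y , z)) elements) elements
    infinite = map (λ z → (0# , 1# , z)) elements

  count-projPoints : ∀ (p : Triple → Bool) → count p projPoints ≡ ∑ℙ² (λ x y z → 𝟙 (p (x , y , z)))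
  count-projPoints p = trans (length-filterᵇ p projPoints) (∑-projPoints (𝟙 ∘ p))

  scale-==0 : ∀ {c} → c ≢0 → ∀ x → (c * x == 0#) ≡ (x == 0#)
  scale-==0 {c} c≢0 x = ⇔⇒≡
    (λ eq → ≡⇒== ([ (λ c≡0 → contradiction c≡0 c≢0) , id ]′ (integral (==⇒≡ eq))))
    (λ eq → ≡⇒== (trans (cong (c *_) (==⇒≡ eq)) (zeroʳ c)))

  form-scale : ∀ C k x y z → form C (k * x , k * y , k * z) ≡ (k * k) * form C (x , y , z)
  form-scale (conic a b c d e f) k x y z = solve 10 (λ a b c d e f k x y z →
    :form a b c d e f (k :* x) (k :* y) (k :* z) := (k :* k) :* :form a b c d e f x y z) refl a b c d e f k x y z

  onLineConic : Conic → Triple → Triple → Bool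
  onLineConic C l P = onConic C P ∧ incident l P

  private
    onLineConic-homogeneous : ∀ C l → Homogeneous³ (λ x y z → 𝟙 (onLineConic C l (x , y , z)))
    onLineConic-homogeneous C (u , v , w) k x y z k≢0 = cong 𝟙 (cong₂ _∧_
      (trans (cong (_== 0#) (form-scale C k x y z)) (scale-==0 (*-≢0 k≢0 k≢0) _))
      (trans (cong (_== 0#) (solve 7 (λ u v w k x y z → u :* (k :* x) :+ v :* (k :* y) :+ w :* (k :* z)
        := k :* (u :* x :+ v :* y :+ w :* z)) refl u v w k x y z)) (scale-==0 k≢0 _)))

    binary-homogeneous : ∀ α β γ → Homogeneous² (λ y z → 𝟙 (binary α β γ y z == 0#))
    binary-homogeneous α β γ k y z k≢0 = cong 𝟙 (trans
      (cong (_== 0#) (solve 6 (λ α β γ k y z → :binary α β γ (k :* y) (k :* z) := (k :* k) :* :binary α β γ y z)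
        refl α β γ k y z))
      (scale-==0 (*-≢0 k≢0 k≢0) _))

    onLineConic-0 : ∀ C l → 𝟙 (onLineConic C l (0# , 0# , 0#)) ≡ 1
    onLineConic-0 (conic a b c d e f) (u , v , w) = cong₂ (λ s t → 𝟙 (s ∧ t))
      (≡⇒== (solve 6 (λ a b c d e f → :form a b c d e f :0 :0 :0 := :0)
        refl a b c d e f))
      (≡⇒== (solve 3 (λ u v w → u :* :0 :+ v :* :0 :+ w :* :0 := :0) refl u v w))

    binary-0 : ∀ α β γ → 𝟙 (binary α β γ 0# 0# == 0#) ≡ 1
    binary-0 α β γ = cong 𝟙 (≡⇒== (solve 3 (λ α β γ →
      :binary α β γ :0 :0 := :0) refl α β γ))

    -- Eliminates one coordinate by the equation of the line, in which that coordinate has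
    -- coefficient 1.
    ∑-solve : ∀ (p : Carrier → Bool) (ℓ : Carrier → Carrier) k → (∀ x → ℓ x ≡ x + k) →
      ∑[ x ← elements ] 𝟙 (p x ∧ (ℓ x == 0#)) ≡ 𝟙 (p (- k))
    ∑-solve p ℓ k ℓ≡ = trans
      (∑-only elements unique (complete (- k)) λ x _ x≢-k → cong 𝟙 (trans
        (cong (p x ∧_) (≢⇒== λ eq → x≢-k (x+y≡0⇒x≡-y x k (trans (sym (ℓ≡ x)) eq)))) (∧-zeroʳ (p x))))
      (cong 𝟙 (trans (cong (p (- k) ∧_) (≡⇒== (trans (ℓ≡ (- k)) (-‿inverseˡ k)))) (∧-identityʳ _)))

  -- α, β, γ are the coefficients of the form restricted to the line l; (p₀, p₁, p₂) is the row completing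
  -- them to the symmetric matrix of C in a basis of which the last two members span l.
  line-roots : ∀ C l α β γ p₀ p₁ p₂ → Irreducible C →
    ∑³ (λ x y z → 𝟙 (onLineConic C l (x , y , z))) ≡ ∑² (λ y z → 𝟙 (binary α β γ y z == 0#)) →
    det C ≡ p₀ * (α * γ + - (β * β)) + - (p₁ * p₁ * γ) + 2# * p₁ * p₂ * β + - (p₂ * p₂ * α) →
    - form (adjugate C) l ≡ β * β + - (α * γ) →
    Roots F (- form (adjugate C) l) (count (onLineConic C l) projPoints)
  line-roots C l α β γ p₀ p₁ p₂ irr restrict det≡ disc = subst₂ (Roots F) (sym disc)
    (trans (projective-count-unique {v = ∑² g} {w = 1} {p = ∑ℙ¹ g} {p′ = ∑ℙ² f}
             (trans (∑²-∑ℙ¹ g (binary-homogeneous α β γ)) (cong (ℕ._+ n ℕ.* ∑ℙ¹ g) (binary-0 α β γ)))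
             (trans (cong (ℕ._+ ∑ℙ² f) (sym restrict)) (trans (∑³-∑ℙ² f (onLineConic-homogeneous C l))
               (cong (ℕ._+ n ℕ.* ∑ℙ² f) (onLineConic-0 C l)))))
           (sym (count-projPoints (onLineConic C l))))
    -- If the form vanished on the whole line, the determinant would be zero, since each term of its
    -- expansion contains α, β or γ.
    (binary-roots α β γ λ where
      (refl , refl , refl) → irr (trans det≡ (solve 3 (λ p₀ p₁ p₂ →
        p₀ :* (:0 :* :0 :- (:0 :* :0)) :- (p₁ :* p₁ :* :0)
          :+ :2 :* p₁ :* p₂ :* :0 :- (p₂ :* p₂ :* :0) := :0) refl p₀ p₁ p₂)))
    where
    f : Carrier → Carrier → Carrier → ℕ
    f x y z = 𝟙 (onLineConic C l (x , y , z))
    g : Carrier → Carrier → ℕ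
    g y z = 𝟙 (binary α β γ y z == 0#)

  LineRoots : Conic → Triple → Set
  LineRoots C l = Roots F (- form (adjugate C) l) (count (onLineConic C l) projPoints)

  -- The basis is (1, 0, 0), (-v, 1, 0), (-w, 0, 1). It has determinant 1, so the matrix of the
  -- conic keeps its determinant. The sums are reordered to make the eliminated coordinate x
  -- innermost.
  line-roots-1vw : ∀ C → Irreducible C → ∀ v w → LineRoots C (1# , v , w)
  line-roots-1vw C@(conic a b c d e f) irr v w = line-roots C (1# , v , w)
    (a * v * v + b + - (2# * d * v)) (a * v * w + f + - (d * w) + - (e * v)) (a * w * w + c + - (2# * e * w))
    a (d + - (a * v)) (e + - (a * w)) irr
    (trans (∑³-swap₁₂ _) (trans (∑³-swap₂₃ _) (∑²-cong λ y z _ _ → trans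
      (∑-solve (λ x → onConic C (x , y , z)) _ (v * y + w * z) λ x →
        solve 5 (λ v w x y z → :1 :* x :+ v :* y :+ w :* z := x :+ (v :* y :+ w :* z)) refl v w x y z)
      (cong (λ t → 𝟙 (t == 0#)) (solve 10 (λ a b c d e f v w y z →
        :form a b c d e f (⊝ (v :* y :+ w :* z)) y z := :binary (a :* v :* v :+ b :- :2 :* d :* v)
          (a :* v :* w :+ f :- d :* w :- e :* v) (a :* w :* w :+ c :- :2 :* e :* w) y z)
        refl a b c d e f v w y z)))))
    (solve 8 (λ a b c d e f v w →
      let α = a :* v :* v :+ b :- :2 :* d :* v
          β = a :* v :* w :+ f :- d :* w :- e :* v
          γ = a :* w :* w :+ c :- :2 :* e :* w
          p₁ = d :- a :* v
          p₂ = e :- a :* w in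
      :det a b c d e f := a :* (α :* γ :- β :* β) :- p₁ :* p₁ :* γ :+ :2 :* p₁ :* p₂ :* β :- p₂ :* p₂ :* α)
      refl a b c d e f v w)
    (solve 8 (λ a b c d e f v w →
      let α = a :* v :* v :+ b :- :2 :* d :* v
          β = a :* v :* w :+ f :- d :* w :- e :* v
          γ = a :* w :* w :+ c :- :2 :* e :* w in
      ⊝ :form (:A* b c f) (:B* a c e) (:C* a b d) (:D* c d e f) (:E* b d e f) (:F* a d e f)
        :1 v w := β :* β :- α :* γ)
      refl a b c d e f v w)

  line-roots-01w : ∀ C → Irreducible C → ∀ w → LineRoots C (0# , 1# , w)
  line-roots-01w C@(conic a b c d e f) irr w = line-roots C (0# , 1# , w)
    a (e + - (d * w)) (c + b * w * w + - (2# * f * w)) b d (f + - (b * w)) irr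
    (trans (∑³-swap₂₃ _) (∑²-cong λ x z _ _ → trans
      (∑-solve (λ y → onConic C (x , y , z)) _ (w * z) λ y →
        solve 4 (λ w x y z → :0 :* x :+ :1 :* y :+ w :* z := y :+ w :* z) refl w x y z)
      (cong (λ t → 𝟙 (t == 0#)) (solve 9 (λ a b c d e f w x z →
        :form a b c d e f x (⊝ (w :* z)) z := :binary a (e :- d :* w) (c :+ b :* w :* w :- :2 :* f :* w) x z)
        refl a b c d e f w x z))))
    (solve 7 (λ a b c d e f w →
      let β = e :- d :* w
          γ = c :+ b :* w :* w :- :2 :* f :* w
          p₂ = f :- b :* w in
      :det a b c d e f := b :* (a :* γ :- β :* β) :- d :* d :* γ :+ :2 :* d :* p₂ :* β :- p₂ :* p₂ :* a)
      refl a b c d e f w)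
    (solve 7 (λ a b c d e f w →
      let β = e :- d :* w
          γ = c :+ b :* w :* w :- :2 :* f :* w in
      ⊝ :form (:A* b c f) (:B* a c e) (:C* a b d) (:D* c d e f) (:E* b d e f) (:F* a d e f)
        :0 :1 w := β :* β :- a :* γ)
      refl a b c d e f w)

  line-roots-001 : ∀ C → Irreducible C → LineRoots C (0# , 0# , 1#)
  line-roots-001 C@(conic a b c d e f) irr = line-roots C (0# , 0# , 1#) a d b c e f irr
    (∑²-cong λ x y _ _ → trans
      (∑-solve (λ z → onConic C (x , y , z)) _ 0# λ z →
        solve 3 (λ x y z → :0 :* x :+ :0 :* y :+ :1 :* z := z :+ :0) refl x y z)
      (cong (λ t → 𝟙 (t == 0#)) (solve 8 (λ a b c d e f x y →
        :form a b c d e f x y (⊝ :0) := :binary a d b x y)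
        refl a b c d e f x y)))
    (solve 6 (λ a b c d e f →
      :det a b c d e f := c :* (a :* b :- d :* d) :- e :* e :* b :+ :2 :* e :* f :* d :- f :* f :* a)
      refl a b c d e f)
    (solve 6 (λ a b c d e f →
      ⊝ :form (:A* b c f) (:B* a c e) (:C* a b d) (:D* c d e f) (:E* b d e f) (:F* a d e f)
        :0 :0 :1 := d :* d :- a :* b)
      refl a b c d e f)

  adjugate-irreducible : ∀ C → Irreducible C → Irreducible (adjugate C)
  adjugate-irreducible C irr eq = *-≢0 irr irr (trans (sym (det-adjugate C)) eq)

  tangent-adjugate : ∀ C l → LineRoots C l → tangent C l ≡ onConic (adjugate C) l
  tangent-adjugate C l roots = aux roots
    where
    D : Carrier
    D = form (adjugate C) l
    nonzero : (- D) ≢0 → (D == 0#) ≡ false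
    nonzero -D≢0 = ≢⇒== λ D≡0 → -D≢0 (trans (cong -_ D≡0) -0#≈0#)
    aux : ∀ {m} → Roots F (- D) m → (m ≡ᵇ 1) ≡ (D == 0#)
    aux (one -D≡0)   = sym (≡⇒== (trans (sym (-‿involutive D)) (trans (cong -_ -D≡0) -0#≈0#)))
    aux (two -D≢0 _) = sym (nonzero -D≢0)
    aux (none ¬sq)   = sym (nonzero λ -D≡0 → ¬sq (0# , trans (zeroˡ 0#) (sym -D≡0)))

  incident-comm : ∀ l P → incident l P ≡ incident P l
  incident-comm (u , v , w) (x , y , z) = cong (_== 0#)
    (cong₂ _+_ (cong₂ _+_ (*-comm u x) (*-comm v y)) (*-comm w z))

  -- Points and lines share the list `projPoints` and incidence is symmetric, so duality needs no
  -- translation: `P` itself is read as a line meeting the dual conic.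
  tangentsThrough-adjugate : ∀ C → Irreducible C → ∀ P →
    tangentsThrough C P ≡ count (onLineConic (adjugate C) P) projPoints
  tangentsThrough-adjugate C irr P = trans (count-projPoints _) (trans
    (∑ℙ²-cong {f = λ x y z → 𝟙 (incident (x , y , z) P ∧ tangent C (x , y , z))}
              {f′ = λ x y z → 𝟙 (onLineConic (adjugate C) P (x , y , z))}
      (λ y z _ _ → dual _ (line-roots-1vw C irr y z))
      (λ z _ → dual _ (line-roots-01w C irr z))
      (dual _ (line-roots-001 C irr)))
    (sym (count-projPoints _)))
    where
    dual : ∀ l → LineRoots C l → 𝟙 (incident l P ∧ tangent C l) ≡ 𝟙 (onLineConic (adjugate C) P l)
    dual l roots = cong 𝟙 (trans (cong₂ _∧_ (incident-comm l P) (tangent-adjugate C l roots)) (∧-comm (incident P l) (onConic (adjugate C) l)))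

  -- The root count for lines is used a second time, now for the dual conic; the double adjugate in
  -- its discriminant returns the original form up to the factor det C.
  external-discriminant : ∀ C P → Irreducible C → LineRoots (adjugate C) P →
    external C P ≡ isNonzeroSquare (- det C * form C P)
  external-discriminant C P irr roots = trans
    (cong (λ m → not (form C P == 0#) ∧ (m ≡ᵇ 2)) (tangentsThrough-adjugate C irr P)) (aux (subst (λ D → Roots F D m) disc roots))
    where
    m : ℕ
    m = count (onLineConic (adjugate C) P) projPoints
    disc : - form (adjugate (adjugate C)) P ≡ - det C * form C P
    disc = trans (cong -_ (form-adjugate² C P)) (-‿distribˡ-* (det C) (form C P))
    aux : ∀ {m} → Roots F (- det C * form C P) m →
      not (form C P == 0#) ∧ (m ≡ᵇ 2) ≡ isNonzeroSquare (- det C * form C P)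
    aux (one D≡0)    = trans (∧-zeroʳ _) (sym (cong (λ t → not t ∧ isSquare (- det C * form C P)) (≡⇒== D≡0)))
    aux (two D≢0 sq) = trans (cong (λ t → not t ∧ true) (≢⇒== (*-≢0⁻ʳ D≢0))) (sym (isNonzeroSquare⁺ D≢0 sq))
    aux (none ¬sq)   = trans (∧-zeroʳ _) (sym (≢true⇒≡false λ eq → ¬sq (proj₂ (isNonzeroSquare⁻ eq))))

  external-1yz : ∀ C → Irreducible C → ∀ y z →
    external C (1# , y , z) ≡ isNonzeroSquare (- det C * form C (1# , y , z))
  external-1yz C irr y z =
    external-discriminant C _ irr (line-roots-1vw (adjugate C) (adjugate-irreducible C irr) y z)

  external-01z : ∀ C → Irreducible C → ∀ z →
    external C (0# , 1# , z) ≡ isNonzeroSquare (- det C * form C (0# , 1# , z))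
  external-01z C irr z =
    external-discriminant C _ irr (line-roots-01w (adjugate C) (adjugate-irreducible C irr) z)

  external-001 : ∀ C → Irreducible C →
    external C (0# , 0# , 1#) ≡ isNonzeroSquare (- det C * form C (0# , 0# , 1#))
  external-001 C irr = external-discriminant C _ irr (line-roots-001 (adjugate C) (adjugate-irreducible C irr))

-- Points of the subplane and changes of coordinates over F_q.

module SubplanePoints (F : FiniteField) (q : ℕ) (q-primePower : IsPrimePower q) (q-odd : OddNat q)
  (5≤q : 5 ≤ q) (order≡q² : FiniteField.order F ≡ q ℕ.* q) where

  open FieldProperties F
  open QuadraticExtension F q q-primePower q-odd order≡q²
  open PlaneGeometry F q hiding (_^_; _==_)
  open IsSubfield Fq-isSubfield
  open ProjectiveSums F Fq-isSubfield hiding (n)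
  open Tangents F q 2≢0
  open ≡-Reasoning
  private module Whole = ProjectiveSums F (wholeField F)

  2≤j : 2 ≤ j
  2≤j with j | q≡1+j*2
  ... | zero        | refl = contradiction 5≤q λ where (s≤s ())
  ... | suc zero    | refl = contradiction 5≤q λ where (s≤s (s≤s (s≤s ())))
  ... | suc (suc _) | _    = s≤s (s≤s z≤n)

  0<j : 0 < j
  0<j = ℕ.<-trans (s≤s z≤n) 2≤j

  |Fq|≡q : length Fq ≡ q
  |Fq|≡q = length-Fq 0<j

  -- This is (q + 1)/2 < q - 1, the comparison for which an odd q has to be at least 5: for q = 3
  -- both sides are 2.
  1+j+1<q : suc (suc j) < q
  1+j+1<q = subst (suc (suc j) <_) (sym q≡1+j*2) (s≤s (subst (suc (suc j) ≤_)
    (trans (cong (j ℕ.+_) (sym (ℕ.+-identityʳ j))) (ℕ.*-comm 2 j)) (ℕ.+-monoˡ-≤ j 2≤j)))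

  -- For δ = -det C this is the indicator of the external points, extended from normal forms to all
  -- vectors. The factor δ is a separate argument, so that it stays fixed while the conic is
  -- transformed.
  squareValues : Carrier → Conic → Carrier → Carrier → Carrier → ℕ
  squareValues δ C x y z = 𝟙 (isNonzeroSquare (δ * form C (x , y , z)))

  private
    ∑-inFq : ∀ (φ : Carrier → ℕ) (p : Carrier → Bool) → (∀ x → p x ≡ inFq x) →
      ∑[ x ← elements ] (𝟙 (p x) ℕ.* φ x) ≡ ∑ Fq φ
    ∑-inFq φ p p≡ = trans (∑-cong elements λ x → cong (λ b → 𝟙 b ℕ.* φ x) (p≡ x)) (sym (∑-filterᵇ inFq φ elements))

    inFq0 : inFq 0# ≡ true
    inFq0 = inFq⁺ 0^q≡0
    inFq1 : inFq 1# ≡ true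
    inFq1 = inFq⁺ (1^n≡1 q)

    Whole-∑ℙ²-inSubplane : ∀ (φ : Carrier → Carrier → Carrier → ℕ) →
      Whole.∑ℙ² (λ x y z → 𝟙 (inSubplane (x , y , z)) ℕ.* φ x y z) ≡ ∑ℙ² φ
    Whole-∑ℙ²-inSubplane φ = cong₂ ℕ._+_
      (trans (∑-cong elements inner) (∑-inFq (λ y → ∑ Fq (φ 1# y)) inFq λ _ → refl))
      (cong₂ ℕ._+_
        (∑-inFq (φ 0# 1#) (λ z → inFq 0# ∧ inFq 1# ∧ inFq z) (λ z → cong₂ (λ b c → b ∧ c ∧ inFq z) inFq0 inFq1))
        (trans (cong₂ (λ b c → 𝟙 (b ∧ b ∧ c) ℕ.* φ 0# 0# 1#) inFq0 inFq1) (ℕ.*-identityˡ _)))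
      where
      inner : ∀ y → ∑[ z ← elements ] (𝟙 (inFq 1# ∧ inFq y ∧ inFq z) ℕ.* φ 1# y z) ≡ 𝟙 (inFq y) ℕ.* ∑ Fq (φ 1# y)
      inner y with inFq y
      ... | true  = trans (∑-inFq (φ 1# y) _ λ z → cong (_∧ inFq z) inFq1) (sym (ℕ.*-identityˡ _))
      ... | false = ∑-zero elements λ z _ → cong (λ b → 𝟙 b ℕ.* φ 1# y z) (∧-zeroʳ (inFq 1#))

  Eq-squareValues : ∀ C → Irreducible C → Eq C ≡ ∑ℙ² (squareValues (- det C) C)
  Eq-squareValues C irr = begin
    Eq C                                                                 ≡⟨ length-filterᵇ (external C) subplanePoints ⟩
    ∑ subplanePoints (𝟙 ∘ external C)                                    ≡⟨ ∑-filterᵇ inSubplane (𝟙 ∘ external C) projPoints ⟩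
    ∑[ P ← projPoints ] (𝟙 (inSubplane P) ℕ.* 𝟙 (external C P))          ≡⟨ ∑-projPoints _ ⟩
    Whole.∑ℙ² (λ x y z → 𝟙 (inSubplane (x , y , z)) ℕ.* 𝟙 (external C (x , y , z)))
      ≡⟨ Whole-∑ℙ²-inSubplane (λ x y z → 𝟙 (external C (x , y , z))) ⟩
    ∑ℙ² (λ x y z → 𝟙 (external C (x , y , z)))
      ≡⟨ ∑ℙ²-cong {f = λ x y z → 𝟙 (external C (x , y , z))} {f′ = squareValues (- det C) C}
           (λ y z _ _ → cong 𝟙 (external-1yz C irr y z)) (λ z _ → cong 𝟙 (external-01z C irr z))
           (cong 𝟙 (external-001 C irr)) ⟩
    ∑ℙ² (squareValues (- det C) C)                                       ∎

  isNonzeroSquare-scale : ∀ {k} → k ≢0 → ∀ x → isNonzeroSquare ((k * k) * x) ≡ isNonzeroSquare x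
  isNonzeroSquare-scale {k} k≢0 x = cong₂ (λ b c → not b ∧ c) (scale-==0 (*-≢0 k≢0 k≢0) x)
    (⇔⇒≡ (λ eq → let r , rr≡ = isSquare⁻ eq in isSquare⁺ (k ⁻¹ * r , (begin
            (k ⁻¹ * r) * (k ⁻¹ * r)        ≡⟨ solve 2 (λ k r → (k :* r) :* (k :* r) := k :* (k :* (r :* r))) refl (k ⁻¹) r ⟩
            k ⁻¹ * (k ⁻¹ * (r * r))        ≡⟨ cong (λ t → k ⁻¹ * (k ⁻¹ * t)) (trans rr≡ (*-assoc k k x)) ⟩
            k ⁻¹ * (k ⁻¹ * (k * (k * x)))  ≡⟨ cong (k ⁻¹ *_) (⁻¹-cancelˡ k≢0 _) ⟩
            k ⁻¹ * (k * x)                 ≡⟨ ⁻¹-cancelˡ k≢0 x ⟩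
            x                              ∎)))
         (λ eq → let r , rr≡ = isSquare⁻ eq in isSquare⁺ (k * r ,
            trans (solve 2 (λ k r → (k :* r) :* (k :* r) := (k :* k) :* (r :* r)) refl k r) (cong ((k * k) *_) rr≡))))

  squareValues-homogeneous : ∀ δ C → Homogeneous³ (squareValues δ C)
  squareValues-homogeneous δ C k x y z k≢0 = cong 𝟙 (trans
    (cong isNonzeroSquare (trans (cong (δ *_) (form-scale C k x y z))
      (solve 3 (λ δ k Q → δ :* ((k :* k) :* Q) := (k :* k) :* (δ :* Q)) refl δ k (form C (x , y , z)))))
    (isNonzeroSquare-scale k≢0 _))

  squareValues-0 : ∀ δ C {P@(x , y , z) : Triple} → form C P ≡ 0# → squareValues δ C x y z ≡ 0
  squareValues-0 δ C eq = cong 𝟙 (≢true⇒≡false λ sq →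
    proj₁ (isNonzeroSquare⁻ sq) (trans (cong (δ *_) eq) (zeroʳ δ)))

  form-0 : ∀ C → form C (0# , 0# , 0#) ≡ 0#
  form-0 (conic a b c d e f) = solve 6 (λ a b c d e f →
    :form a b c d e f :0 :0 :0 := :0) refl a b c d e f

  -- What a change of coordinates over F_q preserves.
  infix 4 _∼_
  record _∼_ (C C′ : Conic) : Set where
    constructor _,_
    field
      det-≡    : det C ≡ det C′
      values-≡ : ∀ (φ : Carrier → ℕ) →
        ∑³ (λ x y z → φ (form C (x , y , z))) ≡ ∑³ (λ x y z → φ (form C′ (x , y , z)))
  open _∼_

  ∼-sym : ∀ {C C′} → C ∼ C′ → C′ ∼ C
  ∼-sym (δ , v) = sym δ , λ φ → sym (v φ)

  ∼-trans : ∀ {C C′ C″} → C ∼ C′ → C′ ∼ C″ → C ∼ C″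
  ∼-trans (δ , v) (δ′ , v′) = trans δ δ′ , λ φ → trans (v φ) (v′ φ)

  ∼-irreducible : ∀ {C C′} → C ∼ C′ → Irreducible C → Irreducible C′
  ∼-irreducible C∼C′ irr eq = irr (trans (det-≡ C∼C′) eq)

  -- The relation only compares sums over vectors; homogeneity and the value 0 at the zero vector
  -- recover the projective counts from them.
  ∼-count : ∀ {C C′} δ → C ∼ C′ → ∑ℙ² (squareValues δ C) ≡ ∑ℙ² (squareValues δ C′)
  ∼-count {C} {C′} δ C∼C′ = projective-count-unique {v = ∑³ (squareValues δ C)} {w = 0} (affine C)
    (trans (cong (ℕ._+ ∑ℙ² (squareValues δ C′)) (values-≡ C∼C′ (λ v → 𝟙 (isNonzeroSquare (δ * v))))) (affine C′))
    where
    affine : ∀ C → ∑³ (squareValues δ C) ℕ.+ ∑ℙ² (squareValues δ C) ≡ length Fq ℕ.* ∑ℙ² (squareValues δ C)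
    affine C = trans (∑³-∑ℙ² (squareValues δ C) (squareValues-homogeneous δ C))
      (cong (ℕ._+ length Fq ℕ.* ∑ℙ² (squareValues δ C)) (squareValues-0 δ C (form-0 C)))

  -- Rationality in terms of values, because `∼` records nothing about individual coefficients
  -- beyond the determinant.
  RationalValues : Carrier → Conic → Set
  RationalValues ℓ C = ∀ {x y z} → x ∈ Fq → y ∈ Fq → z ∈ Fq → (ℓ * form C (x , y , z)) ∈ Fq

  -- Take for φ the indicator of the values v with ℓv outside F_q. Its sum is 0 for `C`, hence 0 for
  -- `C′`, so none of its terms is positive.
  ∼-rational : ∀ {C C′} ℓ → C ∼ C′ → RationalValues ℓ C → RationalValues ℓ C′
  ∼-rational {C} {C′} ℓ C∼C′ rat {x} {y} x∈ y∈ z∈ = ∈Fq⁺ (inFq⁻ (𝟙-not (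
    ∑≡0⇒≡0 (λ z → φ (form C′ (x , y , z))) (∑≡0⇒≡0 (λ y → ∑[ z ← Fq ] φ (form C′ (x , y , z))) (∑≡0⇒≡0
      (λ x → ∑² (λ y z → φ (form C′ (x , y , z)))) (trans (sym (values-≡ C∼C′ φ)) (∑-zero Fq λ x x∈ → ∑-zero Fq λ y y∈ → ∑-zero Fq λ z z∈ →
      cong (𝟙 ∘ not) (inFq⁺ (∈Fq⁻ (rat x∈ y∈ z∈))))) x∈) y∈) z∈)))
    where
    φ : Carrier → ℕ
    φ v = 𝟙 (not (inFq (ℓ * v)))
    𝟙-not : ∀ {b} → 𝟙 (not b) ≡ 0 → b ≡ true
    𝟙-not {true} _ = refl

  swap₁₂ swap₂₃ swap₁₃ : Conic → Conic
  swap₁₂ (conic a b c d e f) = conic b a c d f e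
  swap₂₃ (conic a b c d e f) = conic a c b e d f
  swap₁₃ (conic a b c d e f) = conic c b a f e d

  form-swap₁₂ : ∀ C x y z → form (swap₁₂ C) (x , y , z) ≡ form C (y , x , z)
  form-swap₁₂ (conic a b c d e f) x y z = solve 9 (λ a b c d e f x y z →
    :form b a c d f e x y z := :form a b c d e f y x z) refl a b c d e f x y z

  form-swap₂₃ : ∀ C x y z → form (swap₂₃ C) (x , y , z) ≡ form C (x , z , y)
  form-swap₂₃ (conic a b c d e f) x y z = solve 9 (λ a b c d e f x y z →
    :form a c b e d f x y z := :form a b c d e f x z y) refl a b c d e f x y z

  form-swap₁₃ : ∀ C x y z → form (swap₁₃ C) (x , y , z) ≡ form C (z , y , x)
  form-swap₁₃ (conic a b c d e f) x y z = solve 9 (λ a b c d e f x y z →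
    :form c b a f e d x y z := :form a b c d e f z y x) refl a b c d e f x y z

  ∼-swap₁₂ : ∀ C → C ∼ swap₁₂ C
  ∼-swap₁₂ C@(conic a b c d e f) =
    solve 6 (λ a b c d e f → :det a b c d e f := :det b a c d f e) refl a b c d e f ,
    λ φ → trans (∑³-swap₁₂ _) (∑³-cong λ x y z _ _ _ → cong φ (sym (form-swap₁₂ C x y z)))

  ∼-swap₂₃ : ∀ C → C ∼ swap₂₃ C
  ∼-swap₂₃ C@(conic a b c d e f) =
    solve 6 (λ a b c d e f → :det a b c d e f := :det a c b e d f) refl a b c d e f ,
    λ φ → trans (∑³-swap₂₃ _) (∑³-cong λ x y z _ _ _ → cong φ (sym (form-swap₂₃ C x y z)))

  ∼-swap₁₃ : ∀ C → C ∼ swap₁₃ C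
  ∼-swap₁₃ C@(conic a b c d e f) =
    solve 6 (λ a b c d e f → :det a b c d e f := :det c b a f e d) refl a b c d e f ,
    λ φ → trans (trans (∑³-swap₁₂ _) (trans (∑³-swap₂₃ _) (∑³-swap₁₂ _)))
      (∑³-cong λ x y z _ _ _ → cong φ (sym (form-swap₁₃ C x y z)))

  -- The substitution (x, y, z) ↦ (x + sz, y + tz, z), which moves (0 : 0 : 1) to (s : t : 1).
  shear : Carrier → Carrier → Conic → Conic
  shear s t C@(conic a b c d e f) = conic a b (form C (s , t , 1#)) d (a * s + d * t + e) (d * s + b * t + f)

  -- For fixed z the substitution merely translates x and y by elements of F_q; hence z is made the
  -- outermost summation variable.
  ∼-shear : ∀ {s t} C → s ∈ Fq → t ∈ Fq → C ∼ shear s t C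
  ∼-shear {s} {t} C@(conic a b c d e f) s∈ t∈ =
    solve 8 (λ a b c d e f s t → :det a b c d e f :=
      :det a b (:form a b c d e f s t :1) d (a :* s :+ d :* t :+ e) (d :* s :+ b :* t :+ f))
      refl a b c d e f s t ,
    λ φ → begin
      ∑[ x ← Fq ] ∑[ y ← Fq ] ∑[ z ← Fq ] φ (form C (x , y , z))
        ≡⟨ rotate φ ⟩
      ∑[ z ← Fq ] ∑[ x ← Fq ] ∑[ y ← Fq ] φ (form C (x , y , z))
        ≡⟨ ∑-cong-∈ Fq (λ z z∈ → trans
             (sym (∑-shift (*-∈ s∈ z∈) (λ x → ∑[ y ← Fq ] φ (form C (x , y , z)))))
             (∑-cong Fq (λ x → sym (∑-shift (*-∈ t∈ z∈) (λ y → φ (form C (x + s * z , y , z))))))) ⟩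
      ∑[ z ← Fq ] ∑[ x ← Fq ] ∑[ y ← Fq ] φ (form C (x + s * z , y + t * z , z))
        ≡⟨ ∑³-cong (λ z x y _ _ _ → cong φ (form-shear x y z)) ⟩
      ∑[ z ← Fq ] ∑[ x ← Fq ] ∑[ y ← Fq ] φ (form (shear s t C) (x , y , z))
        ≡⟨ rotate′ φ ⟨
      ∑[ x ← Fq ] ∑[ y ← Fq ] ∑[ z ← Fq ] φ (form (shear s t C) (x , y , z)) ∎
    where
    rotate : ∀ φ → ∑³ (λ x y z → φ (form C (x , y , z))) ≡ ∑³ (λ z x y → φ (form C (x , y , z)))
    rotate φ = trans (∑³-swap₂₃ _) (∑³-swap₁₂ _)
    rotate′ : ∀ φ → ∑³ (λ x y z → φ (form (shear s t C) (x , y , z))) ≡ ∑³ (λ z x y → φ (form (shear s t C) (x , y , z)))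
    rotate′ φ = trans (∑³-swap₂₃ _) (∑³-swap₁₂ _)
    form-shear : ∀ x y z → form C (x + s * z , y + t * z , z) ≡ form (shear s t C) (x , y , z)
    form-shear x y z = solve 11 (λ a b c d e f s t x y z →
      :form a b c d e f (x :+ s :* z) (y :+ t :* z) z
      := :form a b (:form a b c d e f s t :1) d (a :* s :+ d :* t :+ e) (d :* s :+ b :* t :+ f) x y z)
      refl a b c d e f s t x y z

  RationalPoint : Conic → Triple → Set
  RationalPoint C (x , y , z) = (x ∈ Fq × y ∈ Fq × z ∈ Fq) × form C (x , y , z) ≡ 0#

  data Canonical : Triple → Set where
    [1∶y∶z] : ∀ y z → Canonical (1# , y , z)
    [0∶1∶z] : ∀ z → Canonical (0# , 1# , z)
    [0∶0∶1] : Canonical (0# , 0# , 1#)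

  projPoints-canonical : ∀ {P} → P ∈ projPoints → Canonical P
  projPoints-canonical P∈ with ∈-++⁻ (concatMap (λ y → map (λ z → (1# , y , z)) elements) elements) P∈
  ... | inj₁ P∈affine with find (∈-concatMap⁻ (λ y → map (λ z → (1# , y , z)) elements) {xs = elements} P∈affine)
  ...   | y , _ , P∈row with ∈-map⁻ (λ z → (1# , y , z)) P∈row
  ...     | z , _ , refl = [1∶y∶z] y z
  projPoints-canonical P∈ | inj₂ P∈infinite with ∈-++⁻ (map (λ z → (0# , 1# , z)) elements) P∈infinite
  ... | inj₂ (here refl) = [0∶0∶1]
  ... | inj₁ P∈row with ∈-map⁻ (λ z → (0# , 1# , z)) P∈row
  ...   | z , _ , refl = [0∶1∶z] z

  inSubplane⁻ : ∀ (P@(x , y , z) : Triple) → inSubplane P ≡ true → x ∈ Fq × y ∈ Fq × z ∈ Fq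
  inSubplane⁻ (x , y , z) eq with inFq x in x≡ | inFq y in y≡ | inFq z in z≡
  inSubplane⁻ (x , y , z) refl | true | true | true = ∈Fq⁺ (inFq⁻ x≡) , ∈Fq⁺ (inFq⁻ y≡) , ∈Fq⁺ (inFq⁻ z≡)

  meetsSubplane⁻ : ∀ C → MeetsSubplane C → ∃ λ P → Canonical P × RationalPoint C P
  meetsSubplane⁻ C meets with find (AnyP.any⁻ (onConic C) subplanePoints (Equivalence.from T-≡ meets))
  ... | P , P∈ , P-on with ∈-filterᵇ⁻ inSubplane projPoints P∈
  ...   | P∈proj , P-sub = P , projPoints-canonical P∈proj , inSubplane⁻ P P-sub , ==⇒≡ (Equivalence.to T-≡ P-on)

  -- The first condition puts (0 : 0 : 1) on the conic. The tangent there is ex + fy = 0, so the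
  -- second one says that the line x = 0 is not tangent and the tangent has a finite slope.
  Normalized : Conic → Set
  Normalized C = Conic.c C ≡ 0# × (Conic.f C) ≢0

  private
    -- With c = f = 0 the determinant is -be², so e cannot vanish, and exchanging x and y moves it
    -- to the place of f.
    normalize-f : ∀ C → Irreducible C → Conic.c C ≡ 0# → ∃ λ C′ → C ∼ C′ × Normalized C′
    normalize-f C@(conic a b c d e f) irr refl with f ≟ 0#
    ... | no f≢0   = C , (refl , λ _ → refl) , refl , f≢0
    ... | yes refl = swap₁₂ C , ∼-swap₁₂ C , refl , λ where
      refl → irr (solve 3 (λ a b d → :det a b :0 d :0 :0 := :0) refl a b d)

    normalize-st1 : ∀ C {s t} → Irreducible C → s ∈ Fq → t ∈ Fq → form C (s , t , 1#) ≡ 0# →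
      ∃ λ C′ → C ∼ C′ × Normalized C′
    normalize-st1 C irr s∈ t∈ eq =
      let C∼S = ∼-shear C s∈ t∈
          C′ , S∼C′ , norm = normalize-f _ (∼-irreducible C∼S irr) eq
      in C′ , ∼-trans C∼S S∼C′ , norm

  normalize : ∀ C → Irreducible C → MeetsSubplane C → ∃ λ C′ → C ∼ C′ × Normalized C′
  normalize C irr meets with meetsSubplane⁻ C meets
  ... | _ , [0∶0∶1] , (x∈ , y∈ , _) , eq = normalize-st1 C irr x∈ y∈ eq
  ... | _ , [0∶1∶z] z , (x∈ , _ , z∈) , eq =
    let C∼S = ∼-swap₂₃ C
        C′ , S∼C′ , norm = normalize-st1 (swap₂₃ C) (∼-irreducible C∼S irr) x∈ z∈
          (trans (form-swap₂₃ C 0# z 1#) eq)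
    in C′ , ∼-trans C∼S S∼C′ , norm
  ... | _ , [1∶y∶z] y z , (_ , y∈ , z∈) , eq =
    let C∼S = ∼-swap₁₃ C
        C′ , S∼C′ , norm = normalize-st1 (swap₁₃ C) (∼-irreducible C∼S irr) z∈ y∈
          (trans (form-swap₁₃ C z y 1#) eq)
    in C′ , ∼-trans C∼S S∼C′ , norm

-- Conics with coefficients in F_q.

module Rationality (F : FiniteField) (q : ℕ) (q-primePower : IsPrimePower q) (q-odd : OddNat q)
  (5≤q : 5 ≤ q) (order≡q² : FiniteField.order F ≡ q ℕ.* q) where

  open FieldProperties F
  open QuadraticExtension F q q-primePower q-odd order≡q²
  open PlaneGeometry F q hiding (_^_; _==_)
  open IsSubfield Fq-isSubfield
  open ProjectiveSums F Fq-isSubfield hiding (n)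
  open Tangents F q 2≢0
  open SubplanePoints F q q-primePower q-odd 5≤q order≡q²
  open ≡-Reasoning

  ∈Fq? : ∀ x → Dec (x ∈ Fq)
  ∈Fq? x = map′ ∈Fq⁺ ∈Fq⁻ ((x ^ q) ≟ x)

  minus-∈ : ∀ {x y} → x ∈ Fq → y ∈ Fq → (x + - y) ∈ Fq
  minus-∈ x∈ y∈ = +-∈ x∈ (-‿∈ y∈)

  2∈ : 2# ∈ Fq
  2∈ = +-∈ 1∈ 1∈

  halve-∈ : ∀ {x} → (2# * x) ∈ Fq → x ∈ Fq
  halve-∈ {x} 2x∈ = subst (_∈ Fq) (⁻¹-cancelˡ 2≢0 x) (*-∈ (⁻¹-∈ 2∈ 2≢0) 2x∈)

  ratio-∈ : ∀ {ℓ x y} → ℓ ≢0 → y ≢0 → (ℓ * x) ∈ Fq → (ℓ * y) ∈ Fq → (x * y ⁻¹) ∈ Fq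
  ratio-∈ {ℓ} {x} {y} ℓ≢0 y≢0 ℓx∈ ℓy∈ = subst (_∈ Fq) (*-cancelˡ ℓy≢0 (begin
      (ℓ * y) * ((ℓ * y) ⁻¹ * (ℓ * x))  ≡⟨ ⁻¹-cancelʳ ℓy≢0 (ℓ * x) ⟩
      ℓ * x                             ≡⟨ cong (ℓ *_) (⁻¹-cancelʳ y≢0 x) ⟨
      ℓ * (y * (y ⁻¹ * x))              ≡⟨ solve 4 (λ ℓ x y y′ → ℓ :* (y :* (y′ :* x)) := (ℓ :* y) :* (x :* y′)) refl ℓ x y (y ⁻¹) ⟩
      (ℓ * y) * (x * y ⁻¹)              ∎))
    (*-∈ (⁻¹-∈ ℓy∈ ℓy≢0) ℓx∈)
    where
    ℓy≢0 : (ℓ * y) ≢0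
    ℓy≢0 = *-≢0 ℓ≢0 y≢0

  Rational : Carrier → Conic → Set
  Rational ℓ C = All (λ x → (ℓ * x) ∈ Fq) (coeffs C)

  rational⇒values : ∀ {ℓ} C → Rational ℓ C → RationalValues ℓ C
  rational⇒values {ℓ} (conic a b c d e f) (a∈ ∷ b∈ ∷ c∈ ∷ d∈ ∷ e∈ ∷ f∈ ∷ []) {x} {y} {z} x∈ y∈ z∈ = subst (_∈ Fq)
    (solve 10 (λ ℓ a b c d e f x y z →
      :form (ℓ :* a) (ℓ :* b) (ℓ :* c) (ℓ :* d) (ℓ :* e) (ℓ :* f) x y z := ℓ :* :form a b c d e f x y z)
      refl ℓ a b c d e f x y z)
    (+-∈ (+-∈ (+-∈ (+-∈ (+-∈ (*-∈ (*-∈ a∈ x∈) x∈) (*-∈ (*-∈ b∈ y∈) y∈)) (*-∈ (*-∈ c∈ z∈) z∈))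
      (*-∈ (*-∈ (*-∈ 2∈ d∈) x∈) y∈)) (*-∈ (*-∈ (*-∈ 2∈ e∈) x∈) z∈)) (*-∈ (*-∈ (*-∈ 2∈ f∈) y∈) z∈))

  -- Polarization: the form takes the value a at (1, 0, 0), the value a + b + 2d at (1, 1, 0), and so on.
  values⇒rational : ∀ {ℓ} C → RationalValues ℓ C → Rational ℓ C
  values⇒rational {ℓ} (conic a b c d e f) rat = a∈ ∷ b∈ ∷ c∈ ∷ d∈ ∷ e∈ ∷ f∈ ∷ []
    where
    a∈ : (ℓ * a) ∈ Fq
    a∈ = subst (_∈ Fq) (solve 7 (λ ℓ a b c d e f → ℓ :* :form a b c d e f :1 :0 :0 := ℓ :* a) refl ℓ a b c d e f) (rat 1∈ 0∈ 0∈)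
    b∈ : (ℓ * b) ∈ Fq
    b∈ = subst (_∈ Fq) (solve 7 (λ ℓ a b c d e f → ℓ :* :form a b c d e f :0 :1 :0 := ℓ :* b) refl ℓ a b c d e f) (rat 0∈ 1∈ 0∈)
    c∈ : (ℓ * c) ∈ Fq
    c∈ = subst (_∈ Fq) (solve 7 (λ ℓ a b c d e f → ℓ :* :form a b c d e f :0 :0 :1 := ℓ :* c) refl ℓ a b c d e f) (rat 0∈ 0∈ 1∈)
    d∈ : (ℓ * d) ∈ Fq
    d∈ = halve-∈ (subst (_∈ Fq) (solve 7 (λ ℓ a b c d e f →
      ℓ :* :form a b c d e f :1 :1 :0 :- (ℓ :* a :+ ℓ :* b) := :2 :* (ℓ :* d)) refl ℓ a b c d e f)
      (minus-∈ (rat 1∈ 1∈ 0∈) (+-∈ a∈ b∈)))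
    e∈ : (ℓ * e) ∈ Fq
    e∈ = halve-∈ (subst (_∈ Fq) (solve 7 (λ ℓ a b c d e f →
      ℓ :* :form a b c d e f :1 :0 :1 :- (ℓ :* a :+ ℓ :* c) := :2 :* (ℓ :* e)) refl ℓ a b c d e f)
      (minus-∈ (rat 1∈ 0∈ 1∈) (+-∈ a∈ c∈)))
    f∈ : (ℓ * f) ∈ Fq
    f∈ = halve-∈ (subst (_∈ Fq) (solve 7 (λ ℓ a b c d e f →
      ℓ :* :form a b c d e f :0 :1 :1 :- (ℓ :* b :+ ℓ :* c) := :2 :* (ℓ :* f)) refl ℓ a b c d e f)
      (minus-∈ (rat 0∈ 1∈ 1∈) (+-∈ b∈ c∈)))

  definedOverFq⁻ : ∀ C → DefinedOverFq C → ∃ λ ℓ → ℓ ≢0 × Rational ℓ C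
  definedOverFq⁻ C (ℓ , ℓ≢0 , eq) = ℓ , ℓ≢0 , All.map (λ t → ∈Fq⁺ (inFq⁻ (Equivalence.to T-≡ t)))
    (AllP.all⁺ (λ x → inFq (ℓ * x)) (coeffs C) (Equivalence.from T-≡ eq))

  definedOverFq⁺ : ∀ C {ℓ} → ℓ ≢0 → Rational ℓ C → DefinedOverFq C
  definedOverFq⁺ C {ℓ} ℓ≢0 rat = ℓ , ℓ≢0 , Equivalence.to T-≡
    (AllP.all⁻ (λ x → inFq (ℓ * x)) (All.map (λ x∈ → Equivalence.from T-≡ (inFq⁺ (∈Fq⁻ x∈))) rat))

  rational-det-∈ : ∀ {ℓ} C → Rational ℓ C → (ℓ * ℓ * ℓ * det C) ∈ Fq
  rational-det-∈ {ℓ} (conic a b c d e f) (a∈ ∷ b∈ ∷ c∈ ∷ d∈ ∷ e∈ ∷ f∈ ∷ []) = subst (_∈ Fq)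
    (solve 7 (λ ℓ a b c d e f → :det (ℓ :* a) (ℓ :* b) (ℓ :* c) (ℓ :* d) (ℓ :* e) (ℓ :* f)
      := ℓ :* ℓ :* ℓ :* :det a b c d e f) refl ℓ a b c d e f)
    (minus-∈ (minus-∈ (minus-∈ (+-∈ (*-∈ (*-∈ a∈ b∈) c∈) (*-∈ (*-∈ (*-∈ 2∈ d∈) e∈) f∈))
      (*-∈ (*-∈ a∈ f∈) f∈)) (*-∈ (*-∈ b∈ e∈) e∈)) (*-∈ (*-∈ c∈ d∈) d∈))

  -- Multiplied by ℓ⁴, the discriminant lies in F_q, all of whose elements are squares in F.
  rational⇒square : ∀ {ℓ} C → ℓ ≢0 → Rational ℓ C → Irreducible C →
    ∀ {x y z} → x ∈ Fq → y ∈ Fq → z ∈ Fq → form C (x , y , z) ≢0 →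
    isNonzeroSquare (- det C * form C (x , y , z)) ≡ true
  rational⇒square {ℓ} C ℓ≢0 rat irr {x} {y} {z} x∈ y∈ z∈ Q≢0 = trans
    (sym (isNonzeroSquare-scale (*-≢0 ℓ≢0 ℓ≢0) D))
    (isNonzeroSquare⁺ (*-≢0 (*-≢0 (*-≢0 ℓ≢0 ℓ≢0) (*-≢0 ℓ≢0 ℓ≢0)) (*-≢0 (-‿≢0 irr) Q≢0))
      (∈Fq⇒IsSquare 0<j (subst (_∈ Fq)
        (solve 3 (λ ℓ δ Q → ⊝ (ℓ :* ℓ :* ℓ :* δ) :* (ℓ :* Q) := ((ℓ :* ℓ) :* (ℓ :* ℓ)) :* (⊝ δ :* Q)) refl ℓ (det C) Q)
        (*-∈ (-‿∈ (rational-det-∈ C rat)) (rational⇒values C rat x∈ y∈ z∈)))))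
    where
    Q D : Carrier
    Q = form C (x , y , z)
    D = - det C * Q

  -- The pencil of lines through (0 : 0 : 1).

  module Pencil (a b d e f : Carrier) (f≢0 : f ≢0) (irr : Irreducible (conic a b 0# d e f)) (δ : Carrier) where

    C₀ : Conic
    C₀ = conic a b 0# d e f

    -- As c = 0, the form is linear in z, with constant term `A` and slope 2B; the equation B = 0 is
    -- that of the tangent at (0 : 0 : 1).
    A B : Carrier → Carrier → Carrier
    A x y = a * x * x + 2# * d * x * y + b * y * y
    B x y = e * x + f * y

    form-line : ∀ x y z → form C₀ (x , y , z) ≡ A x y + (2# * B x y) * z
    form-line x y z = solve 8 (λ a b d e f x y z → :form a b :0 d e f x y z :=
      (a :* x :* x :+ :2 :* d :* x :* y :+ b :* y :* y) :+ (:2 :* (e :* x :+ f :* y)) :* z)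
      refl a b d e f x y z

    -- Minus the coordinate z of the second intersection with the conic. On the tangent the inverse
    -- takes its default value 0, and `root` is only used where `B` is nonzero.
    root : Carrier → Carrier → Carrier
    root x y = A x y * (2# * B x y) ⁻¹

    2B≢0 : ∀ {x y} → B x y ≢0 → (2# * B x y) ≢0
    2B≢0 = *-≢0 2≢0

    form-root : ∀ {x y} z → B x y ≢0 → form C₀ (x , y , z) ≡ (2# * B x y) * (z + root x y)
    form-root {x} {y} z B≢0 = begin
      form C₀ (x , y , z)                 ≡⟨ form-line x y z ⟩
      A x y + m * z                       ≡⟨ cong (_+ m * z) (⁻¹-cancelʳ (2B≢0 B≢0) (A x y)) ⟨
      m * (m ⁻¹ * A x y) + m * z          ≡⟨ solve 4 (λ m m′ A z → m :* (m′ :* A) :+ m :* z := m :* (z :+ A :* m′))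
                                               refl m (m ⁻¹) (A x y) z ⟩
      m * (z + root x y)                  ∎
      where m = 2# * B x y

    lineSum : Carrier → Carrier → ℕ
    lineSum x y = ∑[ z ← Fq ] squareValues δ C₀ x y z

    s₀ : Carrier
    s₀ = - (e * f ⁻¹)

    fs₀≡-e : f * s₀ ≡ - e
    fs₀≡-e = trans (solve 3 (λ f e f′ → f :* ⊝ (e :* f′) := ⊝ (f :* (f′ :* e))) refl f e (f ⁻¹))
      (cong -_ (⁻¹-cancelʳ f≢0 e))

    B[1,s] : ∀ s → B 1# s ≡ f * (s + - s₀)
    B[1,s] s = begin
      e * 1# + f * s          ≡⟨ solve 3 (λ e f s → e :* :1 :+ f :* s := f :* s :- ⊝ e) refl e f s ⟩
      f * s + - (- e)         ≡⟨ cong (λ t → f * s + - t) fs₀≡-e ⟨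
      f * s + - (f * s₀)      ≡⟨ solve 3 (λ f s t → f :* s :- f :* t := f :* (s :- t)) refl f s s₀ ⟩
      f * (s + - s₀)          ∎

    B[0,1] : B 0# 1# ≡ f
    B[0,1] = solve 2 (λ e f → e :* :0 :+ f :* :1 := f) refl e f

    B[0,1]≢0 : B 0# 1# ≢0
    B[0,1]≢0 eq = f≢0 (trans (sym B[0,1]) eq)

    B[1,s]≢0 : ∀ {s} → ¬ (s ≡ s₀) → B 1# s ≢0
    B[1,s]≢0 {s} s≢s₀ eq = *-≢0 f≢0 (s≢s₀ ∘ x-y≡0⇒x≡y) (trans (sym (B[1,s] s)) eq)

    -- Fixing (x : y) fixes a line of the pencil; the centre (0 : 0 : 1) belongs to all of them but
    -- lies on the conic and contributes 0.
    count-lines : ∑ℙ² (squareValues δ C₀) ≡ ∑[ s ← Fq ] lineSum 1# s ℕ.+ lineSum 0# 1#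
    count-lines = cong (∑[ s ← Fq ] lineSum 1# s ℕ.+_) (trans
      (cong (lineSum 0# 1# ℕ.+_) (squareValues-0 δ C₀ (solve 5 (λ a b d e f →
        :form a b :0 d e f :0 :0 :1 := :0) refl a b d e f)))
      (ℕ.+-identityʳ _))

    ∑-const-Fq : ∀ k → ∑[ _ ← Fq ] k ≡ q ℕ.* k
    ∑-const-Fq k = trans (∑-const Fq k) (cong (ℕ._* k) |Fq|≡q)

    ∑-suc-lineSum : ∑[ s ← Fq ] suc (lineSum 1# s) ≡ q ℕ.+ ∑[ s ← Fq ] lineSum 1# s
    ∑-suc-lineSum = trans (∑-distrib-+ Fq (λ _ → 1) (lineSum 1#))
      (cong (ℕ._+ ∑ Fq (lineSum 1#)) (trans (∑-const-Fq 1) (ℕ.*-identityʳ q)))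

    lineSum-≤ : ∀ x y → lineSum x y ≤ q
    lineSum-≤ x y = ℕ.≤-trans (∑-mono-≤ Fq λ z _ → 𝟙≤1 _)
      (ℕ.≤-reflexive (trans (∑-const-Fq 1) (ℕ.*-identityʳ q)))

    -- By `form-root` the discriminant along the line is c · (z + u) with c = δ · 2B and u =
    -- `root x y`.
    lineSum-∉ : ∀ {x y} → B x y ≢0 → ¬ (root x y ∈ Fq) → suc (lineSum x y) < q
    lineSum-∉ {x} {y} B≢0 u∉ = ℕ.≤-<-trans (s≤s (subst (_≤ suc j)
      (∑-cong Fq λ z → cong (𝟙 ∘ isNonzeroSquare)
        (trans (*-assoc δ _ _) (cong (δ *_) (sym (form-root z B≢0)))))
      (count-squares-≤ u∉))) 1+j+1<q

    suc-∑-≢ : ∀ {r} → r ∈ Fq → suc (∑[ z ← Fq ] 𝟙 (not (z == r))) ≡ q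
    suc-∑-≢ {r} r∈ = begin
      suc (∑[ z ← Fq ] 𝟙 (not (z == r)))   ≡⟨ ℕ.+-comm 1 _ ⟩
      ∑[ z ← Fq ] 𝟙 (not (z == r)) ℕ.+ 1   ≡⟨ ∑-all-but-one Fq L-unique r∈ (λ z _ z≢r → cong (𝟙 ∘ not) (≢⇒== z≢r)) ⟩
      𝟙 (not (r == r)) ℕ.+ length Fq ℕ.* 1 ≡⟨ cong₂ ℕ._+_ (cong (𝟙 ∘ not) (≡⇒== {r} refl))
                                                          (trans (ℕ.*-identityʳ (length Fq)) |Fq|≡q) ⟩
      q                                    ∎

    squareValues-root : ∀ {x y} → B x y ≢0 → squareValues δ C₀ x y (- root x y) ≡ 0
    squareValues-root {x} {y} B≢0 = squareValues-0 δ C₀ (trans (form-root (- root x y) B≢0)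
      (trans (cong ((2# * B x y) *_) (-‿inverseˡ _)) (zeroʳ _)))

    lineSum-< : ∀ {x y} → B x y ≢0 → suc (lineSum x y) ≤ q
    lineSum-< {x} {y} B≢0 with ∈Fq? (root x y)
    ... | no u∉  = ℕ.<⇒≤ (lineSum-∉ B≢0 u∉)
    ... | yes u∈ = ℕ.≤-trans (s≤s (∑-mono-≤ Fq λ z _ → bound z)) (ℕ.≤-reflexive (suc-∑-≢ (-‿∈ u∈)))
      where
      bound : ∀ z → squareValues δ C₀ x y z ≤ 𝟙 (not (z == - root x y))
      bound z with z ≟ (- root x y)
      ... | yes refl = ℕ.≤-reflexive (squareValues-root B≢0)
      ... | no  _    = 𝟙≤1 _

    lineSum-tight : ∀ {x y} → B x y ≢0 → suc (lineSum x y) ≡ q → root x y ∈ Fq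
    lineSum-tight {x} {y} B≢0 eq with ∈Fq? (root x y)
    ... | yes u∈ = u∈
    ... | no u∉  = contradiction eq (ℕ.<⇒≢ (lineSum-∉ B≢0 u∉))

    module _ (count≡q² : ∑ℙ² (squareValues δ C₀) ≡ q ℕ.* q) where

      private
        -- The line joining (0 : 0 : 1) to (1 : s : 0) is tangent exactly for s = s₀.
        bound : Carrier → ℕ
        bound s = q ℕ.+ 𝟙 (s == s₀)

        ≤bound : ∀ s → s ∈ Fq → suc (lineSum 1# s) ≤ bound s
        ≤bound s _ with s ≟ s₀
        ... | yes _   = subst (suc (lineSum 1# s) ≤_) (ℕ.+-comm 1 q) (s≤s (lineSum-≤ 1# s))
        ... | no s≢s₀ = subst (suc (lineSum 1# s) ≤_) (sym (ℕ.+-identityʳ q)) (lineSum-< (B[1,s]≢0 s≢s₀))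

        ∑-bound : ∑ Fq bound ≡ q ℕ.* q ℕ.+ ∑[ s ← Fq ] 𝟙 (s == s₀)
        ∑-bound = trans (∑-distrib-+ Fq (λ _ → q) _) (cong (ℕ._+ ∑ Fq (λ s → 𝟙 (s == s₀))) (∑-const-Fq q))

        -- The q² external points, increased by one for each of the q + 1 lines; this turns the
        -- bound q - 1 on a line into q.
        total : ∑[ s ← Fq ] suc (lineSum 1# s) ℕ.+ suc (lineSum 0# 1#) ≡ (q ℕ.* q ℕ.+ 1) ℕ.+ q
        total = begin
          ∑[ s ← Fq ] suc (lineSum 1# s) ℕ.+ suc l  ≡⟨ cong (ℕ._+ suc l) ∑-suc-lineSum ⟩
          q ℕ.+ L ℕ.+ suc l                         ≡⟨ +-*-Solver.solve 3 (λ q L l → q ⊕ L ⊕ (κ 1 ⊕ l) ⊜ (L ⊕ l) ⊕ κ 1 ⊕ q) refl q L l ⟩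
          L ℕ.+ l ℕ.+ 1 ℕ.+ q                       ≡⟨ cong (λ t → t ℕ.+ 1 ℕ.+ q) (trans (sym count-lines) count≡q²) ⟩
          q ℕ.* q ℕ.+ 1 ℕ.+ q                       ∎
          where
          open +-*-Solver using () renaming (_:+_ to _⊕_; _:=_ to _⊜_; con to κ)
          L = ∑[ s ← Fq ] lineSum 1# s
          l = lineSum 0# 1#

        -- Otherwise none of the q + 1 lines would be tangent, and the total would be at most (q +
        -- 1)(q - 1) = q² - 1.
        s₀∈ : s₀ ∈ Fq
        s₀∈ with ∈Fq? s₀
        ... | yes s₀∈ = s₀∈
        ... | no s₀∉  = contradiction
          (ℕ.≤-trans (ℕ.≤-reflexive (sym total)) (ℕ.+-mono-≤ (∑-mono-≤ Fq ≤bound) (lineSum-< B[0,1]≢0)))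
          (ℕ.<⇒≱ (ℕ.+-monoˡ-< q (subst (ℕ._< q ℕ.* q ℕ.+ 1)
            (sym (trans ∑-bound (cong (q ℕ.* q ℕ.+_)
              (∑-zero Fq λ s s∈ → cong 𝟙 (≢⇒== λ s≡s₀ → s₀∉ (subst (_∈ Fq) s≡s₀ s∈))))))
            (ℕ.+-monoʳ-< (q ℕ.* q) (s≤s z≤n)))))

        tight : ∑[ s ← Fq ] suc (lineSum 1# s) ℕ.+ suc (lineSum 0# 1#) ≡ ∑ Fq bound ℕ.+ q
        tight = trans total (cong (ℕ._+ q) (sym (trans ∑-bound (cong (q ℕ.* q ℕ.+_)
          (trans (∑-only Fq L-unique s₀∈ λ s _ s≢s₀ → cong 𝟙 (≢⇒== s≢s₀)) (cong 𝟙 (≡⇒== {s₀} refl)))))))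

        root[0,1]∈ : root 0# 1# ∈ Fq
        root[0,1]∈ = lineSum-tight B[0,1]≢0 (+-mono-≤-tightʳ (∑-mono-≤ Fq ≤bound) (lineSum-< B[0,1]≢0) tight)

        root[1,s]∈ : ∀ {s} → s ∈ Fq → ¬ (s ≡ s₀) → root 1# s ∈ Fq
        root[1,s]∈ {s} s∈ s≢s₀ = lineSum-tight (B[1,s]≢0 s≢s₀) (trans
          (∑-mono-≤-tight Fq ≤bound (+-mono-≤-tightˡ (∑-mono-≤ Fq ≤bound) (lineSum-< B[0,1]≢0) tight) s s∈)
          (trans (cong (λ t → q ℕ.+ 𝟙 t) (≢⇒== s≢s₀)) (ℕ.+-identityʳ q)))

        -- Scales the coefficient 2f of yz to 1; then `root 0# 1#` is the scaled coefficient ℓb.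
        ℓ : Carrier
        ℓ = (2# * f) ⁻¹

        2f≢0 : (2# * f) ≢0
        2f≢0 = *-≢0 2≢0 f≢0

        ℓb∈ : (ℓ * b) ∈ Fq
        ℓb∈ = subst (_∈ Fq) (begin
          A 0# 1# * (2# * B 0# 1#) ⁻¹  ≡⟨ cong₂ (λ s t → s * (2# * t) ⁻¹) (solve 3 (λ a b d →
            a :* :0 :* :0 :+ :2 :* d :* :0 :* :1
              :+ b :* :1 :* :1 := b) refl a b d) B[0,1] ⟩
          b * ℓ                        ≡⟨ *-comm b ℓ ⟩
          ℓ * b                        ∎) root[0,1]∈

        -- Since 2B(1, s) = 2f(s - s₀), the element ℓ · A(1, s) is the product of `root 1# s` and s
        -- - s₀.
        ℓA∈ : ∀ {s} → s ∈ Fq → ¬ (s ≡ s₀) → (ℓ * A 1# s) ∈ Fq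
        ℓA∈ {s} s∈ s≢s₀ = subst (_∈ Fq) (sym (begin
          ℓ * α                                ≡⟨ *-identityʳ _ ⟨
          ℓ * α * 1#                           ≡⟨ cong (ℓ * α *_) (⁻¹-inverseʳ (2B≢0 (B[1,s]≢0 s≢s₀))) ⟨
          ℓ * α * (m * m ⁻¹)                   ≡⟨ cong (λ t → ℓ * α * (2# * t * m ⁻¹)) (B[1,s] s) ⟩
          ℓ * α * (2# * (f * (s + - s₀)) * m ⁻¹)
            ≡⟨ solve 5 (λ ℓ α f t m′ → ℓ :* α :* (:2 :* (f :* t) :* m′) := ℓ :* ((:2 :* f) :* (α :* m′ :* t)))
                 refl ℓ α f (s + - s₀) (m ⁻¹) ⟩
          ℓ * ((2# * f) * (α * m ⁻¹ * (s + - s₀)))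
            ≡⟨ ⁻¹-cancelˡ 2f≢0 _ ⟩
          α * m ⁻¹ * (s + - s₀)                ∎)) (*-∈ (root[1,s]∈ s∈ s≢s₀) (minus-∈ s∈ s₀∈))
          where
          α = A 1# s
          m = 2# * B 1# s

        -- Interpolation nodes for the quadratic A(1, s), whose leading coefficient b is already
        -- known. The tangent slope s₀ gives no information, so its two neighbours are taken; their
        -- values differ by 4(d + bs₀).
        s₁ s₂ : Carrier
        s₁ = s₀ + 1#
        s₂ = s₀ + - 1#

        s₁∈ : s₁ ∈ Fq
        s₁∈ = +-∈ s₀∈ 1∈

        s₀+t≢s₀ : ∀ {t} → t ≢0 → ¬ (s₀ + t ≡ s₀)
        s₀+t≢s₀ t≢0 eq = t≢0 (+-cancelˡ s₀ _ _ (trans eq (sym (+-identityʳ s₀))))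

        ℓA₁∈ : (ℓ * A 1# s₁) ∈ Fq
        ℓA₁∈ = ℓA∈ s₁∈ (s₀+t≢s₀ 1≢0)

        ℓA₂∈ : (ℓ * A 1# s₂) ∈ Fq
        ℓA₂∈ = ℓA∈ (minus-∈ s₀∈ 1∈) (s₀+t≢s₀ (-‿≢0 1≢0))

        :A : ∀ {n} (a b d x y : Polynomial n) → Polynomial n
        :A a b d x y = a :* x :* x :+ :2 :* d :* x :* y :+ b :* y :* y

        ℓd∈ : (ℓ * d) ∈ Fq
        ℓd∈ = halve-∈ (halve-∈ (subst (_∈ Fq)
          (solve 5 (λ ℓ a b d s → ℓ :* :A a b d :1 (s :+ :1) :- ℓ :* :A a b d :1 (s :- :1)
            :- :2 :* (:2 :* (ℓ :* b :* s)) := :2 :* (:2 :* (ℓ :* d))) refl ℓ a b d s₀)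
          (minus-∈ (minus-∈ ℓA₁∈ ℓA₂∈) (*-∈ 2∈ (*-∈ 2∈ (*-∈ ℓb∈ s₀∈))))))

        ℓa∈ : (ℓ * a) ∈ Fq
        ℓa∈ = subst (_∈ Fq)
          (solve 5 (λ ℓ a b d s → ℓ :* :A a b d :1 s :- :2 :* (ℓ :* d :* s) :- ℓ :* b :* s :* s
            := ℓ :* a) refl ℓ a b d s₁)
          (minus-∈ (minus-∈ ℓA₁∈ (*-∈ 2∈ (*-∈ ℓd∈ s₁∈))) (*-∈ (*-∈ ℓb∈ s₁∈) s₁∈))

        ℓf∈ : (ℓ * f) ∈ Fq
        ℓf∈ = halve-∈ (subst (_∈ Fq) (trans (sym (⁻¹-inverseˡ 2f≢0))
          (solve 2 (λ ℓ f → ℓ :* (:2 :* f) := :2 :* (ℓ :* f)) refl ℓ f)) 1∈)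

        ℓe∈ : (ℓ * e) ∈ Fq
        ℓe∈ = subst (_∈ Fq) (begin
          - (ℓ * f * s₀)     ≡⟨ solve 3 (λ ℓ f s → ⊝ (ℓ :* f :* s) := ℓ :* ⊝ (f :* s)) refl ℓ f s₀ ⟩
          ℓ * - (f * s₀)     ≡⟨ cong (λ t → ℓ * - t) fs₀≡-e ⟩
          ℓ * - (- e)        ≡⟨ cong (ℓ *_) (-‿involutive e) ⟩
          ℓ * e              ∎) (-‿∈ (*-∈ ℓf∈ s₀∈))

      count⇒rational : ∃ λ ℓ → ℓ ≢0 × Rational ℓ C₀
      count⇒rational = ℓ , ⁻¹-≢0 2f≢0 ,
        (ℓa∈ ∷ ℓb∈ ∷ subst (_∈ Fq) (sym (zeroʳ ℓ)) 0∈ ∷ ℓd∈ ∷ ℓe∈ ∷ ℓf∈ ∷ [])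

    module _ {ℓ} (ℓ≢0 : ℓ ≢0) (rat : Rational ℓ C₀)
      (squares : ∀ {x y z} → x ∈ Fq → y ∈ Fq → z ∈ Fq → form C₀ (x , y , z) ≢0 →
        isNonzeroSquare (δ * form C₀ (x , y , z)) ≡ true) where

      private
        ℓA∈ : ∀ {x y} → x ∈ Fq → y ∈ Fq → (ℓ * A x y) ∈ Fq
        ℓA∈ {x} {y} x∈ y∈ = case rat of λ { (a∈ ∷ b∈ ∷ _ ∷ d∈ ∷ _) → subst (_∈ Fq)
          (solve 6 (λ ℓ a b d x y → ℓ :* a :* x :* x :+ :2 :* (ℓ :* d) :* x :* y :+ ℓ :* b :* y :* y
            := ℓ :* (a :* x :* x :+ :2 :* d :* x :* y :+ b :* y :* y)) refl ℓ a b d x y)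
          (+-∈ (+-∈ (*-∈ (*-∈ a∈ x∈) x∈) (*-∈ (*-∈ (*-∈ 2∈ d∈) x∈) y∈)) (*-∈ (*-∈ b∈ y∈) y∈)) }

        ℓ2B∈ : ∀ {x y} → x ∈ Fq → y ∈ Fq → (ℓ * (2# * B x y)) ∈ Fq
        ℓ2B∈ {x} {y} x∈ y∈ = case rat of λ { (_ ∷ _ ∷ _ ∷ _ ∷ e∈ ∷ f∈ ∷ []) → subst (_∈ Fq)
          (solve 5 (λ ℓ e f x y → :2 :* (ℓ :* e :* x :+ ℓ :* f :* y) := ℓ :* (:2 :* (e :* x :+ f :* y)))
            refl ℓ e f x y)
          (*-∈ 2∈ (+-∈ (*-∈ e∈ x∈) (*-∈ f∈ y∈))) }

        s₀∈ : s₀ ∈ Fq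
        s₀∈ = case rat of λ where (_ ∷ _ ∷ _ ∷ _ ∷ e∈ ∷ f∈ ∷ []) → -‿∈ (ratio-∈ ℓ≢0 f≢0 e∈ f∈)

        lineSum-nontangent : ∀ {x y} → x ∈ Fq → y ∈ Fq → B x y ≢0 → suc (lineSum x y) ≡ q
        lineSum-nontangent {x} {y} x∈ y∈ B≢0 = trans (cong suc (∑-cong-∈ Fq value))
          (suc-∑-≢ (-‿∈ (ratio-∈ ℓ≢0 (2B≢0 B≢0) (ℓA∈ x∈ y∈) (ℓ2B∈ x∈ y∈))))
          where
          value : ∀ z → z ∈ Fq → squareValues δ C₀ x y z ≡ 𝟙 (not (z == - root x y))
          value z z∈ with z ≟ (- root x y)
          ... | yes refl = squareValues-root B≢0
          ... | no z≢-u  = cong 𝟙 (squares x∈ y∈ z∈ λ Q≡0 →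
            *-≢0 (2B≢0 B≢0) (z≢-u ∘ x+y≡0⇒x≡-y z (root x y)) (trans (sym (form-root z B≢0)) Q≡0))

        -- The determinant is -f² · A(1, s₀). Geometrically, the form is constant along the tangent,
        -- and the value 0 would put the whole line on the conic.
        A[1,s₀]≢0 : A 1# s₀ ≢0
        A[1,s₀]≢0 A≡0 = irr (begin
          det C₀
            ≡⟨ solve 5 (λ a b d e f → :det a b :0 d e f :=
                 ⊝ (a :* f :* f :+ :2 :* d :* f :* ⊝ e :+ b :* ⊝ e :* ⊝ e)) refl a b d e f ⟩
          - (a * f * f + 2# * d * f * - e + b * - e * - e)
            ≡⟨ cong (λ t → - (a * f * f + 2# * d * f * t + b * t * t)) fs₀≡-e ⟨
          - (a * f * f + 2# * d * f * (f * s₀) + b * (f * s₀) * (f * s₀))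
            ≡⟨ solve 5 (λ a b d f s → ⊝ (a :* f :* f :+ :2 :* d :* f :* (f :* s) :+ b :* (f :* s) :* (f :* s))
                 := ⊝ (f :* f) :* (a :* :1 :* :1 :+ :2 :* d :* :1 :* s :+ b :* s :* s))
                 refl a b d f s₀ ⟩
          - (f * f) * A 1# s₀
            ≡⟨ trans (cong (- (f * f) *_) A≡0) (zeroʳ _) ⟩
          0# ∎)

        lineSum-tangent : lineSum 1# s₀ ≡ q
        lineSum-tangent = trans (∑-cong-∈ Fq λ z z∈ → cong 𝟙 (squares 1∈ s₀∈ z∈ λ Q≡0 →
            A[1,s₀]≢0 (trans (sym (value z)) Q≡0)))
          (trans (∑-const-Fq 1) (ℕ.*-identityʳ q))
          where
          value : ∀ z → form C₀ (1# , s₀ , z) ≡ A 1# s₀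
          value z = begin
            form C₀ (1# , s₀ , z)                            ≡⟨ form-line 1# s₀ z ⟩
            A 1# s₀ + 2# * B 1# s₀ * z                       ≡⟨ cong (λ t → A 1# s₀ + 2# * t * z) (B[1,s] s₀) ⟩
            A 1# s₀ + 2# * (f * (s₀ + - s₀)) * z             ≡⟨ solve 4 (λ α f s z →
              α :+ :2 :* (f :* (s :- s)) :* z := α) refl (A 1# s₀) f s₀ z ⟩
            A 1# s₀                                          ∎

      rational⇒count : ∑ℙ² (squareValues δ C₀) ≡ q ℕ.* q
      -- The added 2q + 1 consists of q for the successors over s in F_q, one for the line x = 0,
      -- and q for the term that `∑-all-but-one` requires on its left.
      rational⇒count = trans count-lines (ℕ.+-cancelʳ-≡ (suc (q ℕ.+ q)) _ _ (begin
        L ℕ.+ l ℕ.+ suc (q ℕ.+ q)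
          ≡⟨ +-*-Solver.solve 3 (λ q L l → L ⊕ l ⊕ (κ 1 ⊕ (q ⊕ q)) ⊜ (q ⊕ L ⊕ q) ⊕ (κ 1 ⊕ l)) refl q L l ⟩
        (q ℕ.+ L ℕ.+ q) ℕ.+ suc l
          ≡⟨ cong₂ (λ s t → (s ℕ.+ q) ℕ.+ t) (sym ∑-suc-lineSum) (lineSum-nontangent 0∈ 1∈ B[0,1]≢0) ⟩
        (∑[ s ← Fq ] suc (lineSum 1# s) ℕ.+ q) ℕ.+ q
          ≡⟨ cong (ℕ._+ q) (∑-all-but-one Fq L-unique s₀∈ λ s s∈ s≢s₀ → lineSum-nontangent 1∈ s∈ (B[1,s]≢0 s≢s₀)) ⟩
        (suc (lineSum 1# s₀) ℕ.+ length Fq ℕ.* q) ℕ.+ q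
          ≡⟨ cong₂ (λ s t → (suc s ℕ.+ t ℕ.* q) ℕ.+ q) lineSum-tangent |Fq|≡q ⟩
        (suc q ℕ.+ q ℕ.* q) ℕ.+ q
          ≡⟨ +-*-Solver.solve 2 (λ q q² → (κ 1 ⊕ q ⊕ q²) ⊕ q ⊜ q² ⊕ (κ 1 ⊕ (q ⊕ q))) refl q (q ℕ.* q) ⟩
        q ℕ.* q ℕ.+ suc (q ℕ.+ q) ∎))
        where
        open +-*-Solver using () renaming (_:+_ to _⊕_; _:=_ to _⊜_; con to κ)
        L = ∑[ s ← Fq ] lineSum 1# s
        l = lineSum 0# 1#

  -- Both directions pass through a normalized conic. The determinant is unchanged, so the same δ
  -- governs both counts, and rationality carries over with the same factor ℓ.
  Eq≡q²⇔definedOverFq : ∀ C → Irreducible C → MeetsSubplane C → (Eq C ≡ q ℕ.* q) ⇔ DefinedOverFq C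
  Eq≡q²⇔definedOverFq C irr meets with normalize C irr meets
  ... | C₀@(conic a b _ d e f) , C∼C₀ , refl , f≢0 = mk⇔
    (λ E≡q² → let ℓ , ℓ≢0 , rat = count⇒rational (trans (sym Eq≡) E≡q²) in
      definedOverFq⁺ C ℓ≢0 (values⇒rational C (∼-rational ℓ (∼-sym C∼C₀) (rational⇒values C₀ rat))))
    (λ def → let ℓ , ℓ≢0 , rat = definedOverFq⁻ C def
                 rat₀ = values⇒rational C₀ (∼-rational ℓ C∼C₀ (rational⇒values C rat)) in
      trans Eq≡ (rational⇒count ℓ≢0 rat₀ (rational⇒square C₀ ℓ≢0 rat₀ irr₀)))
    where
    irr₀ : Irreducible C₀
    irr₀ = ∼-irreducible C∼C₀ irr
    open Pencil a b d e f f≢0 irr₀ (- det C₀) using (count⇒rational; rational⇒count)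
    Eq≡ : Eq C ≡ ∑ℙ² (squareValues (- det C₀) C₀)
    Eq≡ = trans (Eq-squareValues C irr) (trans (∼-count (- det C) C∼C₀)
      (cong (λ δ → ∑ℙ² (squareValues (- δ) C₀)) (_∼_.det-≡ C∼C₀)))

open import Data.Nat using (ℕ; _≤_; _*_)

theorem1p1 : (q : ℕ) → IsPrimePower q → OddNat q → 5 ≤ q →
    (F : FiniteField) → FiniteField.order F ≡ q * q →
    (C : PlaneGeometry.Conic F q) →
    PlaneGeometry.Irreducible F q C →
    PlaneGeometry.MeetsSubplane F q C →
    (PlaneGeometry.Eq F q C ≡ q * q) ⇔ PlaneGeometry.DefinedOverFq F q C
theorem1p1 q q-primePower q-odd 5≤q F order≡q² =
  Rationality.Eq≡q²⇔definedOverFq F q q-primePower q-odd 5≤q order≡q²
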